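{- Let $0<1/n\ll \varepsilon\ll \xi\ll \gamma\ll 1/r$ where $n,r\in\mathbb N$ and $r\ge 3$. Suppose that $G$ is a digraph on $n$ vertices such that for every $x\in V(G)$, $d^+(x)\ge (1-1/r-\varepsilon)n$ or $d^-(x)\ge(1-1/r-\varepsilon)n$. Further suppose that $G$ does not contain any $\gamma$-independent set of size at least $n/r$. Then $V(G)$ contains a set $M$ with $|M|\le \xi n$ such that $M$ is a $T_r$-absorbing set for every $W\subseteq V(G)\setminus M$ with $|W|\in r\mathbb N$ and $|W|\le \xi^2 n$.
   Context: Hierarchy notation: $0<a\ll b\ll c$ means the constants are chosen from right to left, each sufficiently small in terms of those to its right (there are increasing functions $f,g$ such that the statement holds whenever $b\le f(c)$ and $a\le g(b)$); longer hierarchies are analogous. A digraph has no loops and at most one edge in each direction between any two vertices; $d^\pm(x)$ are out-/indegree. $T_r$ is the transitive tournament on $r$ vertices. For a digraph $G$ on $n$ vertices, $S\subseteq V(G)$ is $\gamma$-independent if $G[S]$ has at most $\gamma n^2$ edges. A set $S\subseteq V(G)$ is a $T_r$-absorbing set for $Q\subseteq V(G)$ if both $G[S]$ and $G[S\cup Q]$ contain perfect $T_r$-packings (collections of vertex-disjoint, not necessarily induced, copies of $T_r$ covering all vertices).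
   Formalization: The constants γ, ξ and ε in the hierarchy, which the English takes to be real, range over the positive rationals only, and the thresholds they must not exceed are rational as well. -}

module Defs where

open import Data.Nat using (ℕ; zero; suc)
open import Data.Integer using (+_)
open import Data.Rational using (ℚ; _/_; 0ℚ)
open import Data.Bool using (Bool; true; false; if_then_else_)
open import Data.Fin using (Fin; _<_)
open import Data.Fin.Subset using (Subset; _∈_; ∣_∣; _∩_)
open import Data.Vec using (tabulate; lookup)
open import Data.List using (map; allFin)
open import Data.Nat.ListAction using (sum)
open import Data.Product using (Σ; _×_; ∃-syntax)
open import Relation.Binary.PropositionalEquality using (_≡_)
open import Function.Bundles using (_⇔_)

toℚ : ℕ → ℚ
toℚ n = + n / 1

-- 1/r for r ≥ 1 (value at 0 irrelevant; only used with r ≥ 3)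
inv : ℕ → ℚ
inv zero = 0ℚ
inv (suc k) = + 1 / suc k

-- A digraph on vertex set Fin n: adj x y = true iff there is an edge x → y.
-- No loops; at most one edge in each direction is automatic.
record Digraph (n : ℕ) : Set where
  field
    adj      : Fin n → Fin n → Bool
    loopless : ∀ x → adj x x ≡ false
open Digraph public

outNbhd : ∀ {n} → Digraph n → Fin n → Subset n
outNbhd G x = tabulate (λ y → adj G x y)

inNbhd : ∀ {n} → Digraph n → Fin n → Subset n
inNbhd G x = tabulate (λ y → adj G y x)

outdeg : ∀ {n} → Digraph n → Fin n → ℕ
outdeg G x = ∣ outNbhd G x ∣

indeg : ∀ {n} → Digraph n → Fin n → ℕ
indeg G x = ∣ inNbhd G x ∣

edgesIn : ∀ {n} → Digraph n → Subset n → ℕ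
edgesIn {n} G S =
  sum (map (λ x → if lookup S x then ∣ S ∩ outNbhd G x ∣ else 0) (allFin n))

γIndependent : ∀ {n} → Digraph n → ℚ → Subset n → Set
γIndependent {n} G γ S = toℚ (edgesIn G S) Data.Rational.≤ γ Data.Rational.* toℚ (n Data.Nat.* n)

IsTrCopy : ∀ {n} → Digraph n → (r : ℕ) → (Fin r → Fin n) → Set
IsTrCopy G r f =
  (∀ i j → f i ≡ f j → i ≡ j) × (∀ i j → i < j → adj G (f i) (f j) ≡ true)

PerfectTrPacking : ∀ {n} → Digraph n → (r : ℕ) → Subset n → Set
PerfectTrPacking {n} G r S =
  Σ ℕ λ k → Σ (Fin k → Fin r → Fin n) λ c →
    (∀ j → IsTrCopy G r (c j)) ×
    (∀ j j' i i' → c j i ≡ c j' i' → (j ≡ j') × (i ≡ i')) ×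
    (∀ v → v ∈ S ⇔ (∃[ j ] ∃[ i ] c j i ≡ v))

TrAbsorbing : ∀ {n} → Digraph n → (r : ℕ) → Subset n → Subset n → Set
TrAbsorbing G r S Q =
  PerfectTrPacking G r S × PerfectTrPacking G r (S Data.Fin.Subset.∪ Q)

{-# OPTIONS --safe #-}
-- A vertex x of large out- (in-)degree dominates (is dominated by) a set N(x) of
-- about (1 - 1/r)n vertices.  For any two vertices x and y, choose vertices greedily
-- in N(x) ∩ N(y), intersecting each time with the set N(v) of the chosen vertex v.
-- After r - 3 steps about n/r vertices are left, which span many edges because there
-- is no γ-independent set.  A vertex joined in one direction to a transitive
-- tournament extends it, so there are Ω(n^(r-1)) copies of T_{r-1} which form a T_r
-- both with x and with y.  Linking in this way the vertices of a copy of T_r to those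
-- of an r-set Q shows that Q has Ω(n^(r²)) absorbing r²-sets.
--
-- The usual random choice of a family of disjoint absorbing sets is derandomised:
-- each r-tuple Q carries a weight that doubles whenever the next chosen set does not
-- absorb Q, and by averaging the next set can be chosen so as to absorb a constant
-- proportion of the total weight.  After linearly many rounds the total weight shows
-- that every Q is absorbed linearly often, and W is absorbed greedily, r vertices
-- at a time.
module Submission where

open import Defs
open import Data.Bool using (Bool; true; false; if_then_else_; _∧_; _∨_; not)
open import Data.Empty as Empty using (⊥-elim)
open import Data.Fin as Fin using (Fin; zero; suc; toℕ)
import Data.Fin.Properties as Fin
open import Data.Fin.Subset using (Subset; _∈_; _∉_; ∣_∣; _∩_; _∪_; ⊥)
open import Data.Fin.Subset.Properties using (p⊆p∪q; p⊆q⇒∣p∣≤∣q∣; ∣⊥∣≡0; x∈p∪q⁻; x∈p∪q⁺)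
open import Data.List.Base using (List; []; _∷_; _++_; map; length; concat; allFin; lookup; cartesianProductWith)
import Data.List.Properties as List
open import Data.List.Membership.Propositional using () renaming (_∈_ to _∈ₗ_; _∉_ to _∉ₗ_)
import Data.List.Membership.Propositional.Properties as ∈ₗ
open import Data.List.Relation.Binary.Permutation.Propositional
  using (_↭_; ↭-refl; ↭-sym; ↭-trans; ↭-reflexive; prep; ↭⇒↭ₛ; module PermutationReasoning)
import Data.List.Relation.Binary.Permutation.Propositional.Properties as Perm
open import Data.List.Relation.Unary.All as All using (All; []; _∷_)
import Data.List.Relation.Unary.All.Properties as All
open import Data.List.Relation.Unary.AllPairs as AllPairs using (AllPairs; []; _∷_)
import Data.List.Relation.Unary.AllPairs.Properties as AllPairs
open import Data.List.Relation.Unary.Any as Any using (here; there)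
import Data.List.Relation.Unary.Any.Properties as Any
open import Data.List.Relation.Unary.Unique.Propositional using (Unique)
import Data.List.Relation.Unary.Unique.Propositional.Properties as Unique
import Data.Nat.Properties as ℕ
open import Data.Nat.ListAction using (sum)
open import Data.Nat.Tactic.RingSolver using (solve-∀)
open import Data.Product using (Σ; _×_; _,_; proj₁; proj₂; ∃-syntax)
open import Data.Sum using (_⊎_; inj₁; inj₂)
import Data.Vec.Base as Vec
import Data.Vec.Properties as Vec
open import Function.Base using (_∘_; id)
open import Function.Bundles using (_⇔_; mk⇔; Equivalence)
open import Relation.Binary.PropositionalEquality
  using (_≡_; _≢_; refl; sym; trans; cong; cong₂; subst; subst₂; setoid)
open import Relation.Nullary using (¬_; Dec; yes; no; does)
open import Relation.Nullary.Decidable using (dec-true)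

module Combinatorics where

  open import Data.Nat.Base hiding (_/_; _%_)
  open import Data.Nat.DivMod
    using (_/_; _%_; m≡m%n+[m/n]*n; m%n≤n; m/n*n≤m; m*n/n≡m; /-monoˡ-≤; m≥n⇒m/n>0)
  open import Data.Nat.Divisibility using (_∣_; divides)

  private variable
    A B : Set
    n : ℕ

  -- Sums and cardinalities

  ∑ : (A → ℕ) → List A → ℕ
  ∑ f xs = sum (map f xs)

  ∑-mono : {f g : A → ℕ} → (∀ x → f x ≤ g x) → ∀ xs → ∑ f xs ≤ ∑ g xs
  ∑-mono f≤g []       = z≤n
  ∑-mono f≤g (x ∷ xs) = ℕ.+-mono-≤ (f≤g x) (∑-mono f≤g xs)

  ∑-cong : {f g : A → ℕ} → (∀ x → f x ≡ g x) → ∀ xs → ∑ f xs ≡ ∑ g xs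
  ∑-cong f≡g []       = refl
  ∑-cong f≡g (x ∷ xs) = cong₂ _+_ (f≡g x) (∑-cong f≡g xs)

  ∑-+ : (f g : A → ℕ) → ∀ xs → ∑ (λ x → f x + g x) xs ≡ ∑ f xs + ∑ g xs
  ∑-+ f g []       = refl
  ∑-+ f g (x ∷ xs) rewrite ∑-+ f g xs = interchange (f x) (g x) (∑ f xs) (∑ g xs)
    where
    interchange : ∀ a b c d → a + b + (c + d) ≡ a + c + (b + d)
    interchange = solve-∀

  ∑-*ˡ : ∀ c (f : A → ℕ) xs → ∑ (λ x → c * f x) xs ≡ c * ∑ f xs
  ∑-*ˡ c f []       = sym (ℕ.*-zeroʳ c)
  ∑-*ˡ c f (x ∷ xs) rewrite ∑-*ˡ c f xs = sym (ℕ.*-distribˡ-+ c (f x) (∑ f xs))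

  ∑-const : ∀ c (xs : List A) → ∑ (λ _ → c) xs ≡ length xs * c
  ∑-const c []       = refl
  ∑-const c (x ∷ xs) = cong (c +_) (∑-const c xs)

  ∑-swap : (f : A → B → ℕ) → ∀ xs ys →
           ∑ (λ x → ∑ (f x) ys) xs ≡ ∑ (λ y → ∑ (λ x → f x y) xs) ys
  ∑-swap f []       ys = sym (trans (∑-const 0 ys) (ℕ.*-zeroʳ (length ys)))
  ∑-swap f (x ∷ xs) ys rewrite ∑-swap f xs ys = sym (∑-+ (f x) (λ y → ∑ (λ x → f x y) xs) ys)

  ≤∑ : (f : A → ℕ) → ∀ {x xs} → x ∈ₗ xs → f x ≤ ∑ f xs
  ≤∑ f (here refl) = ℕ.m≤m+n _ _
  ≤∑ f (there x∈)  = ℕ.≤-trans (≤∑ f x∈) (ℕ.m≤n+m _ _)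

  -- The witness is a running maximum of `f` started at `a`. It may be `a` itself, which does no
  -- harm, since only the inequality matters later.
  pigeonhole : (f : A → ℕ) → A → ∀ xs → ∃[ x ] ∑ f xs ≤ length xs * f x
  pigeonhole f a []       = a , z≤n
  pigeonhole f a (x ∷ xs) with pigeonhole f a xs
  ... | y , p with ℕ.≤-total (f x) (f y)
  ...   | inj₁ fx≤fy = y , ℕ.+-mono-≤ fx≤fy p
  ...   | inj₂ fy≤fx = x , ℕ.+-monoʳ-≤ (f x) (ℕ.≤-trans p (ℕ.*-monoʳ-≤ (length xs) fy≤fx))

  ⟦_⟧ : Bool → ℕ
  ⟦ b ⟧ = if b then 1 else 0

  card : (Fin n → Bool) → ℕ
  card S = ∑ (⟦_⟧ ∘ S) (allFin _)

  length-allFin : ∀ n → length (allFin n) ≡ n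
  length-allFin n = List.length-tabulate {n = n} id

  ∑-allFin-suc : (f : Fin (suc n) → ℕ) → ∑ f (allFin (suc n)) ≡ f zero + ∑ (f ∘ suc) (allFin n)
  ∑-allFin-suc {n} f = cong (λ xs → f zero + sum xs)
    (trans (List.map-tabulate suc f) (sym (List.map-tabulate id (f ∘ suc))))

  ∣S∣≡card : (S : Subset n) → ∣ S ∣ ≡ card (Vec.lookup S)
  ∣S∣≡card Vec.[] = refl
  ∣S∣≡card (b Vec.∷ S) rewrite ∑-allFin-suc (⟦_⟧ ∘ Vec.lookup (b Vec.∷ S)) with b
  ... | true  = cong suc (∣S∣≡card S)
  ... | false = ∣S∣≡card S

  ∣tabulate∣≡card : (f : Fin n → Bool) → ∣ Vec.tabulate f ∣ ≡ card f
  ∣tabulate∣≡card f = trans (∣S∣≡card (Vec.tabulate f))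
    (∑-cong (λ x → cong ⟦_⟧ (Vec.lookup∘tabulate f x)) (allFin _))

  lookup-∩ : (S T : Subset n) → ∀ x → Vec.lookup (S ∩ T) x ≡ Vec.lookup S x ∧ Vec.lookup T x
  lookup-∩ S T x = Vec.lookup-zipWith _∧_ x S T

  card≤n : (S : Fin n → Bool) → card S ≤ n
  card≤n {n} S = begin
    card S                     ≤⟨ ∑-mono (λ x → ⟦b⟧≤1 (S x)) (allFin n) ⟩
    ∑ (λ _ → 1) (allFin n)     ≡⟨ ∑-const 1 (allFin n) ⟩
    length (allFin n) * 1      ≡⟨ ℕ.*-identityʳ _ ⟩
    length (allFin n)          ≡⟨ length-allFin n ⟩
    n                          ∎
    where
    open ℕ.≤-Reasoning
    ⟦b⟧≤1 : ∀ b → ⟦ b ⟧ ≤ 1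
    ⟦b⟧≤1 true  = ℕ.≤-refl
    ⟦b⟧≤1 false = z≤n

  -- Inclusion-exclusion, with the union bounded by `n` and no truncated subtraction.
  card-∧ : (S T : Fin n → Bool) → card S + card T ≤ card (λ x → S x ∧ T x) + n
  card-∧ {n} S T = begin
    card S + card T                               ≡⟨ ∑-+ (⟦_⟧ ∘ S) (⟦_⟧ ∘ T) (allFin n) ⟨
    ∑ (λ x → ⟦ S x ⟧ + ⟦ T x ⟧) (allFin n)          ≤⟨ ∑-mono (λ x → pointwise (S x) (T x)) (allFin n) ⟩
    ∑ (λ x → ⟦ S x ∧ T x ⟧ + 1) (allFin n)          ≡⟨ ∑-+ _ (λ _ → 1) (allFin n) ⟩
    card (λ x → S x ∧ T x) + ∑ (λ _ → 1) (allFin n) ≡⟨ cong (card (λ x → S x ∧ T x) +_) (∑-const 1 (allFin n)) ⟩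
    card (λ x → S x ∧ T x) + length (allFin n) * 1 ≡⟨ cong (card (λ x → S x ∧ T x) +_) (trans (ℕ.*-identityʳ _) (length-allFin n)) ⟩
    card (λ x → S x ∧ T x) + n                     ∎
    where
    open ℕ.≤-Reasoning
    pointwise : ∀ a b → ⟦ a ⟧ + ⟦ b ⟧ ≤ ⟦ a ∧ b ⟧ + 1
    pointwise true  true  = ℕ.≤-refl
    pointwise true  false = ℕ.≤-refl
    pointwise false true  = ℕ.≤-refl
    pointwise false false = z≤n

  member : Fin n → List (Fin n) → Bool
  member v U = does (Any.any? (v Fin.≟_) U)

  member⁻ : ∀ {v : Fin n} U → member v U ≡ true → v ∈ₗ U
  member⁻ {v = v} U eq with Any.any? (v Fin.≟_) U
  ... | yes v∈U = v∈U

  member⁻-false : ∀ {v : Fin n} U → member v U ≡ false → v ∉ₗ U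
  member⁻-false {v = v} U eq with Any.any? (v Fin.≟_) U
  ... | no v∉U = v∉U

  member⁺ : ∀ {v : Fin n} {U} → v ∈ₗ U → member v U ≡ true
  member⁺ {v = v} {U} v∈U = dec-true (Any.any? (v Fin.≟_) U) v∈U

  card-singleton : (u : Fin n) → card (λ v → does (v Fin.≟ u)) ≡ 1
  card-singleton {suc n} zero rewrite ∑-allFin-suc (λ v → ⟦ does (v Fin.≟ zero {n}) ⟧) =
    cong suc (trans (∑-const 0 (allFin n)) (ℕ.*-zeroʳ (length (allFin n))))
  card-singleton {suc n} (suc u) rewrite ∑-allFin-suc (λ v → ⟦ does (v Fin.≟ suc u) ⟧) =
    card-singleton u

  card-member : (U : List (Fin n)) → card (λ v → member v U) ≤ length U
  card-member {n} []      = ℕ.≤-reflexive (trans (∑-const 0 (allFin n)) (ℕ.*-zeroʳ (length (allFin n))))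
  card-member {n} (u ∷ U) = begin
    card (λ v → member v (u ∷ U))                                            ≤⟨ ∑-mono (λ v → ⟦∨⟧ (does (v Fin.≟ u)) (member v U)) (allFin n) ⟩
    ∑ (λ v → ⟦ does (v Fin.≟ u) ⟧ + ⟦ member v U ⟧) (allFin n)                ≡⟨ ∑-+ (λ v → ⟦ does (v Fin.≟ u) ⟧) _ (allFin n) ⟩
    card (λ v → does (v Fin.≟ u)) + card (λ v → member v U)                  ≤⟨ ℕ.+-mono-≤ (ℕ.≤-reflexive (card-singleton u)) (card-member U) ⟩
    suc (length U)                                                           ∎
    where
    open ℕ.≤-Reasoning
    ⟦∨⟧ : ∀ a b → ⟦ a ∨ b ⟧ ≤ ⟦ a ⟧ + ⟦ b ⟧
    ⟦∨⟧ true  b = s≤s z≤n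
    ⟦∨⟧ false b = ℕ.≤-refl

  card-∖ : (S : Fin n → Bool) (U : List (Fin n)) →
           card S ≤ card (λ v → S v ∧ not (member v U)) + length U
  card-∖ {n} S U = begin
    card S                                                        ≤⟨ ∑-mono (λ v → pointwise (S v) (member v U)) (allFin n) ⟩
    ∑ (λ v → ⟦ S v ∧ not (member v U) ⟧ + ⟦ member v U ⟧) (allFin n) ≡⟨ ∑-+ (λ v → ⟦ S v ∧ not (member v U) ⟧) _ (allFin n) ⟩
    card S∖U + card (λ v → member v U)                             ≤⟨ ℕ.+-monoʳ-≤ (card S∖U) (card-member U) ⟩
    card S∖U + length U                                            ∎
    where
    open ℕ.≤-Reasoning
    S∖U = λ v → S v ∧ not (member v U)
    pointwise : ∀ a b → ⟦ a ⟧ ≤ ⟦ a ∧ not b ⟧ + ⟦ b ⟧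
    pointwise true  true  = ℕ.≤-refl
    pointwise true  false = ℕ.≤-refl
    pointwise false b     = z≤n

  ∧-true⁻ : ∀ {a b} → a ∧ b ≡ true → a ≡ true × b ≡ true
  ∧-true⁻ {true} {true} refl = refl , refl

  not-true⁻ : ∀ {a} → not a ≡ true → a ≡ false
  not-true⁻ {false} refl = refl

  -- Choosing tuples entry by entry

  -- Rich e k P: a k-tuple satisfying P can be chosen entry by entry, with at
  -- least e admissible choices at every step.
  data Rich (e : ℕ) : ℕ → (List (Fin n) → Set) → Set₁ where
    leaf : {P : List (Fin n) → Set} → P [] → Rich e zero P
    node : ∀ {k} {P : List (Fin n) → Set} (S : Fin n → Bool) → e ≤ card S →
           (∀ v → S v ≡ true → Rich e k (λ vs → P (v ∷ vs))) → Rich e (suc k) P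

  Rich-map : ∀ {e k} {P Q : List (Fin n) → Set} →
             (∀ vs → length vs ≡ k → P vs → Q vs) → Rich e k P → Rich e k Q
  Rich-map f (leaf p)      = leaf (f [] refl p)
  Rich-map f (node S e≤ h) =
    node S e≤ λ v v∈ → Rich-map (λ vs len → f (v ∷ vs) (cong suc len)) (h v v∈)

  Rich-bind : ∀ {e k l} {P Q : List (Fin n) → Set} → Rich e k P →
              (∀ vs → length vs ≡ k → P vs → Rich e l (λ ws → Q (vs ++ ws))) → Rich e (k + l) Q
  Rich-bind (leaf p)      f = f [] refl p
  Rich-bind (node S e≤ h) f =
    node S e≤ λ v v∈ → Rich-bind (h v v∈) (λ vs len → f (v ∷ vs) (cong suc len))

  -- Each chosen vertex joins `U` while `k` drops by one, so `length U + k` is constant. It bounds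
  -- the number of vertices excluded at any step, and at least `e` of the `e′` choices survive.
  Rich-avoid : ∀ {e e′ k} {P : List (Fin n) → Set} (U : List (Fin n)) → e + (length U + k) ≤ e′ →
               Rich e′ k P → Rich e k (λ vs → P vs × Unique vs × All (_∉ₗ U) vs)
  Rich-avoid U le (leaf p) = leaf (p , [] , [])
  Rich-avoid {e = e} {e′} {suc k} U le (node S e′≤ h) = node S∖U e≤ step
    where
    open ℕ.≤-Reasoning
    S∖U = λ v → S v ∧ not (member v U)
    e≤ : e ≤ card S∖U
    e≤ = ℕ.+-cancelʳ-≤ (length U) e (card S∖U) (begin
      e + length U               ≤⟨ ℕ.+-monoʳ-≤ e (ℕ.m≤m+n (length U) (suc k)) ⟩
      e + (length U + suc k)     ≤⟨ le ⟩
      e′                         ≤⟨ e′≤ ⟩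
      card S                     ≤⟨ card-∖ S U ⟩
      card S∖U + length U        ∎)
    step : ∀ v → S∖U v ≡ true → Rich e k _
    step v v∈ = Rich-map
      (λ vs _ (p , uniq , avoids) →
        p
        , All.map (λ w∉ v≡w → w∉ (here (sym v≡w))) avoids ∷ uniq
        , member⁻-false U (not-true⁻ (proj₂ (∧-true⁻ {S v} v∈))) ∷ All.map (λ w∉ w∈ → w∉ (there w∈)) avoids)
      (Rich-avoid (v ∷ U)
        (subst (λ m → e + m ≤ e′) (ℕ.+-suc (length U) k) le)
        (h v (proj₁ (∧-true⁻ v∈))))

  -- w′ is the restriction of w to a set of items a for which vs satisfies P a; by
  -- averaging, a share (d / n)^k of the total weight can be retained.
  choose : ∀ {d} k (xs : List A) (w : A → ℕ) {P : A → List (Fin n) → Set} → Fin n →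
           (∀ a → w a ≡ 0 ⊎ Rich d k (P a)) →
           ∃[ vs ] ∃[ w′ ] (∀ a → w′ a ≡ 0 ⊎ (w′ a ≡ w a × P a vs))
                         × length vs ≡ k × d ^ k * ∑ w xs ≤ n ^ k * ∑ w′ xs
  choose zero    xs w x₀ rich = [] , w , hit , refl , ℕ.≤-refl
    where
    hit : ∀ a → w a ≡ 0 ⊎ (w a ≡ w a × _)
    hit a with rich a
    ... | inj₁ w≡0 = inj₁ w≡0
    ... | inj₂ (leaf p) = inj₂ (refl , p)
  choose {A = A} {n = n} {d} (suc k) xs w {P} x₀ rich = v ∷ vs , w′ , hit , cong suc len , bound
    where
    open ℕ.≤-Reasoning
    branch : ∀ a → Σ (Fin n → Bool) λ S → d * w a ≤ w a * card S ×
             (∀ v → ⟦ S v ⟧ * w a ≡ 0 ⊎ Rich d k (λ vs → P a (v ∷ vs)))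
    branch a with rich a
    -- An item of weight zero gets no admissible vertex; both sides of the inequality vanish.
    ... | inj₁ w≡0 rewrite w≡0 =
      (λ _ → false) , ℕ.≤-reflexive (ℕ.*-zeroʳ d) , λ v → inj₁ refl
    ... | inj₂ (node S d≤ h) =
      S , ℕ.≤-trans (ℕ.*-monoˡ-≤ (w a) d≤) (ℕ.≤-reflexive (ℕ.*-comm (card S) (w a))) , next
      where
      next : ∀ v → ⟦ S v ⟧ * w a ≡ 0 ⊎ _
      next v with S v in eq
      ... | true  = inj₂ (h v eq)
      ... | false = inj₁ refl
    S : A → Fin n → Bool
    S a = proj₁ (branch a)
    -- `wᵥ v` is the weight that survives the choice of `v`. Summed over `v`, each item of nonzero
    -- weight is counted once for each of its at least `d` admissible vertices, so some `v` keeps a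
    -- share d / n.
    wᵥ : Fin n → A → ℕ
    wᵥ v a = ⟦ S a v ⟧ * w a
    average = pigeonhole (λ v → ∑ (wᵥ v) xs) x₀ (allFin n)
    v = proj₁ average
    average≤ : d * ∑ w xs ≤ n * ∑ (wᵥ v) xs
    average≤ = begin
      d * ∑ w xs                                ≡⟨ ∑-*ˡ d w xs ⟨
      ∑ (λ a → d * w a) xs                      ≤⟨ ∑-mono (λ a → proj₁ (proj₂ (branch a))) xs ⟩
      ∑ (λ a → w a * card (S a)) xs             ≡⟨ ∑-cong (λ a → sym (∑-*ˡ (w a) (⟦_⟧ ∘ S a) (allFin n))) xs ⟩
      ∑ (λ a → ∑ (λ v → w a * ⟦ S a v ⟧) (allFin n)) xs
                                                ≡⟨ ∑-swap (λ a v → w a * ⟦ S a v ⟧) xs (allFin n) ⟩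
      ∑ (λ v → ∑ (λ a → w a * ⟦ S a v ⟧) xs) (allFin n)
                                                ≡⟨ ∑-cong (λ v → ∑-cong (λ a → ℕ.*-comm (w a) ⟦ S a v ⟧) xs) (allFin n) ⟩
      ∑ (λ v → ∑ (wᵥ v) xs) (allFin n)          ≤⟨ proj₂ average ⟩
      length (allFin n) * ∑ (wᵥ v) xs           ≡⟨ cong (_* ∑ (wᵥ v) xs) (length-allFin n) ⟩
      n * ∑ (wᵥ v) xs                           ∎
    rec = choose k xs (wᵥ v) x₀ (λ a → proj₂ (proj₂ (branch a)) v)
    vs = proj₁ rec
    w′ = proj₁ (proj₂ rec)
    len = proj₁ (proj₂ (proj₂ (proj₂ rec)))
    hit : ∀ a → w′ a ≡ 0 ⊎ (w′ a ≡ w a × P a (v ∷ vs))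
    hit a with proj₁ (proj₂ (proj₂ rec)) a
    ... | inj₁ w′≡0 = inj₁ w′≡0
    ... | inj₂ (w′≡ , p) with S a v
    ...   | true  = inj₂ (trans w′≡ (ℕ.*-identityˡ (w a)) , p)
    ...   | false = inj₁ w′≡
    bound : d ^ suc k * ∑ w xs ≤ n ^ suc k * ∑ w′ xs
    bound = begin
      d * d ^ k * ∑ w xs              ≡⟨ swap d (d ^ k) (∑ w xs) ⟩
      d ^ k * (d * ∑ w xs)            ≤⟨ ℕ.*-monoʳ-≤ (d ^ k) average≤ ⟩
      d ^ k * (n * ∑ (wᵥ v) xs)       ≡⟨ swap n (d ^ k) (∑ (wᵥ v) xs) ⟨
      n * d ^ k * ∑ (wᵥ v) xs         ≡⟨ ℕ.*-assoc n (d ^ k) _ ⟩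
      n * (d ^ k * ∑ (wᵥ v) xs)       ≤⟨ ℕ.*-monoʳ-≤ n (proj₂ (proj₂ (proj₂ (proj₂ rec)))) ⟩
      n * (n ^ k * ∑ w′ xs)           ≡⟨ ℕ.*-assoc n (n ^ k) _ ⟨
      n * n ^ k * ∑ w′ xs             ∎
      where
      swap : ∀ a b c → a * b * c ≡ b * (a * c)
      swap = solve-∀

  -- Absorbers

  -- Used to lift a set slightly smaller than n / r to a size at which density applies. The first
  -- `j` missing elements are added; if there are fewer than `j`, the union is everything.
  extend : (S : Subset n) (j : ℕ) →
           ∃[ X ] ∣ X ∣ ≤ j × (n ≤ ∣ S ∪ X ∣ ⊎ ∣ S ∣ + j ≤ ∣ S ∪ X ∣)
  extend Vec.[] j = Vec.[] , z≤n , inj₁ z≤n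
  extend (true Vec.∷ S) j with extend S j
  ... | X , X≤ , inj₁ n≤ = false Vec.∷ X , X≤ , inj₁ (s≤s n≤)
  ... | X , X≤ , inj₂ S≤ = false Vec.∷ X , X≤ , inj₂ (s≤s S≤)
  extend {suc n} (false Vec.∷ S) zero =
    ⊥ , ℕ.≤-reflexive (∣⊥∣≡0 (suc n)) ,
    inj₂ (ℕ.≤-trans (ℕ.≤-reflexive (ℕ.+-identityʳ _)) (p⊆q⇒∣p∣≤∣q∣ {p = false Vec.∷ S} (p⊆p∪q ⊥)))
  extend (false Vec.∷ S) (suc j) with extend S j
  ... | X , X≤ , inj₁ n≤ = true Vec.∷ X , s≤s X≤ , inj₁ (s≤s n≤)
  ... | X , X≤ , inj₂ S≤ =
    true Vec.∷ X , s≤s X≤ , inj₂ (ℕ.≤-trans (ℕ.≤-reflexive (ℕ.+-suc _ j)) (s≤s S≤))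

  module _ (G : Digraph n) (r : ℕ) where

    Edge : Fin n → Fin n → Set
    Edge x y = adj G x y ≡ true

    -- The order of `xs` is irrelevant; `ys` lists the same vertices in the transitive order.
    TrSet : List (Fin n) → Set
    TrSet xs = ∃[ ys ] ys ↭ xs × AllPairs Edge ys

    -- Lists serve as multisets, so copies may overlap here and packings can be joined freely.
    -- Disjointness enters only once the whole list is known to be duplicate-free.
    Packable : List (Fin n) → Set
    Packable xs = ∃[ L ] All (λ ys → AllPairs Edge ys × length ys ≡ r) L × concat L ↭ xs

    Packable-[] : Packable []
    Packable-[] = [] , [] , ↭-refl

    Packable-↭ : ∀ {xs ys} → xs ↭ ys → Packable xs → Packable ys
    Packable-↭ xs↭ys (L , copies , L↭xs) = L , copies , ↭-trans L↭xs xs↭ys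

    Packable-++ : ∀ {xs ys} → Packable xs → Packable ys → Packable (xs ++ ys)
    Packable-++ (L , copies , L↭xs) (L′ , copies′ , L′↭ys) =
      L ++ L′ , All.++⁺ copies copies′ ,
      ↭-trans (↭-reflexive (sym (List.concat-++ L L′))) (Perm.++⁺ L↭xs L′↭ys)

    TrSet⇒Packable : ∀ {xs} → TrSet xs → length xs ≡ r → Packable xs
    TrSet⇒Packable (ys , ys↭xs , edges) len =
      ys ∷ [] , (edges , trans (Perm.↭-length ys↭xs) len) ∷ [] ,
      ↭-trans (↭-reflexive (List.++-identityʳ ys)) ys↭xs

  -- `large` reads |N x| ≥ (1 - 1/r)n - e/r without subtraction. The same `e` is the error in the
  -- degrees, the number of choices per step and, through `dense`, the measure of density.
  module Absorber (G : Digraph n) (t r e : ℕ) (r≡3+t : r ≡ 3 + t)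
    (N : Fin n → Fin n → Bool)
    (oneSided : ∀ x → (∀ y → N x y ≡ true → Edge G r x y) ⊎ (∀ y → N x y ≡ true → Edge G r y x))
    (large : ∀ x → r * n ≤ r * card (N x) + (n + e))
    (dense : ∀ (S : Subset n) → n ≤ r * ∣ S ∣ → 4 * e * n < edgesIn G S)
    (small : 2 * (r * e) ≤ n)
    where

    instance
      r≢0 : NonZero r
      r≢0 = subst NonZero (sym r≡3+t) _

    -- x is put in front of or behind a transitive tournament inside N x,
    -- according to the direction of N x
    TrSet-∷ : ∀ {x xs} → TrSet G r xs → All (λ y → N x y ≡ true) xs → TrSet G r (x ∷ xs)
    TrSet-∷ {x} {xs} (ys , ys↭xs , edges) near with oneSided x
    ... | inj₁ out = x ∷ ys , prep x ys↭xs , All.map (out _) (Perm.All-resp-↭ (↭-sym ys↭xs) near) ∷ edges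
    ... | inj₂ inn =
      ys ++ x ∷ [] , ↭-trans (↭-sym (Perm.∷↭∷ʳ x ys)) (prep x ys↭xs) ,
      AllPairs.++⁺ edges ([] ∷ [])
        (All.map (λ y∈ → inn _ y∈ ∷ []) (Perm.All-resp-↭ (↭-sym ys↭xs) near))

    -- By `small`, n / r is at least 2e, so a set that misses n / r by at most `e` still has `e`
    -- elements.
    e≤card : ∀ (S : Fin n → Bool) → n + e ≤ r * (card S + e) → e ≤ card S
    e≤card S le = ℕ.*-cancelˡ-≤ r (ℕ.+-cancelʳ-≤ (r * e) _ _ (begin
      r * e + r * e            ≡⟨ cong (r * e +_) (ℕ.+-identityʳ (r * e)) ⟨
      2 * (r * e)              ≤⟨ small ⟩
      n                        ≤⟨ ℕ.m≤m+n n e ⟩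
      n + e                    ≤⟨ le ⟩
      r * (card S + e)         ≡⟨ ℕ.*-distribˡ-+ r (card S) e ⟩
      r * card S + r * e       ∎))
      where open ℕ.≤-Reasoning

    -- If fewer than e vertices of S had e out-neighbours in S, then adding at most
    -- e vertices to S would give a set of size n / r spanning at most 4en edges.
    richEdges : ∀ (S : Fin n → Bool) → n + e ≤ r * (card S + e) →
                Rich e 2 (λ zs → TrSet G r zs × All (λ z → S z ≡ true) zs)
    richEdges S le = result
      where
      open ℕ.≤-Reasoning
      outIn : Fin n → Fin n → Bool
      outIn u v = S v ∧ adj G u v
      heavy : Fin n → Bool
      heavy u = S u ∧ does (e ℕ.≤? card (outIn u))

      fromHeavy : ∀ u → heavy u ≡ true → S u ≡ true × e ≤ card (outIn u)
      fromHeavy u eq = split (e ℕ.≤? card (outIn u)) eq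
        where
        split : ∀ {a c} (e≤c? : Dec (e ≤ c)) → a ∧ does e≤c? ≡ true → a ≡ true × e ≤ c
        split (yes e≤c) eq = proj₁ (∧-true⁻ eq) , e≤c
        split {a} (no _) eq with () ← proj₂ (∧-true⁻ {a} eq)

      few⇒⊥ : card heavy < e → Empty.⊥
      few⇒⊥ few = ℕ.<⇒≱ (dense S′ n≤rS′) edges≤
        where
        S₀ = Vec.tabulate S
        extension = extend S₀ e
        X = proj₁ extension
        S′ = S₀ ∪ X
        X≤e = ℕ.≤-trans (ℕ.≤-reflexive (sym (∣S∣≡card X))) (proj₁ (proj₂ extension))

        n≤rS′ : n ≤ r * ∣ S′ ∣
        n≤rS′ with proj₂ (proj₂ extension)
        ... | inj₁ n≤ = ℕ.≤-trans n≤ (ℕ.m≤n*m ∣ S′ ∣ r)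
        ... | inj₂ S≤ = begin
          n                     ≤⟨ ℕ.m≤m+n n e ⟩
          n + e                 ≤⟨ le ⟩
          r * (card S + e)      ≡⟨ cong (λ c → r * (c + e)) (∣tabulate∣≡card S) ⟨
          r * (∣ S₀ ∣ + e)      ≤⟨ ℕ.*-monoʳ-≤ r S≤ ⟩
          r * ∣ S′ ∣            ∎

        lookup-S′ : ∀ v → Vec.lookup S′ v ≡ S v ∨ Vec.lookup X v
        lookup-S′ v = trans (Vec.lookup-zipWith _∨_ v S₀ X)
          (cong (_∨ Vec.lookup X v) (Vec.lookup∘tabulate S v))

        degree≤ : ∀ u → ∣ S′ ∩ outNbhd G u ∣ ≤ card (outIn u) + e
        degree≤ u = begin
          ∣ S′ ∩ outNbhd G u ∣                    ≡⟨ ∣S∣≡card (S′ ∩ outNbhd G u) ⟩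
          card (Vec.lookup (S′ ∩ outNbhd G u))    ≤⟨ ∑-mono pointwise (allFin n) ⟩
          ∑ (λ v → ⟦ outIn u v ⟧ + ⟦ Vec.lookup X v ⟧) (allFin n)
                                                  ≡⟨ ∑-+ (λ v → ⟦ outIn u v ⟧) _ (allFin n) ⟩
          card (outIn u) + card (Vec.lookup X)    ≤⟨ ℕ.+-monoʳ-≤ (card (outIn u)) X≤e ⟩
          card (outIn u) + e                      ∎
          where
          distrib : ∀ a b c → ⟦ (a ∨ b) ∧ c ⟧ ≤ ⟦ a ∧ c ⟧ + ⟦ b ⟧
          distrib true  b     true  = s≤s z≤n
          distrib true  b     false = z≤n
          distrib false true  true  = ℕ.≤-refl
          distrib false true  false = z≤n
          distrib false false c     = z≤n
          pointwise : ∀ v → ⟦ Vec.lookup (S′ ∩ outNbhd G u) v ⟧ ≤ ⟦ outIn u v ⟧ + ⟦ Vec.lookup X v ⟧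
          pointwise v rewrite lookup-∩ S′ (outNbhd G u) v | lookup-S′ v | Vec.lookup∘tabulate (adj G u) v =
            distrib (S v) (Vec.lookup X v) (adj G u v)

        degree≤n : ∀ u → ∣ S′ ∩ outNbhd G u ∣ ≤ n
        degree≤n u = ℕ.≤-trans (ℕ.≤-reflexive (∣S∣≡card (S′ ∩ outNbhd G u))) (card≤n _)

        -- Heavy vertices and vertices of `X` are charged `n`, and there are at most 2e of them. Any
        -- other vertex of `S′` has fewer than `e` out-neighbours in `S` and at most `e` in `X`.
        -- Together this gives 2en + 2en.
        contribution : ∀ u → (if Vec.lookup S′ u then ∣ S′ ∩ outNbhd G u ∣ else 0)
                           ≤ (e + e) + n * (⟦ heavy u ⟧ + ⟦ Vec.lookup X u ⟧)
        contribution u rewrite lookup-S′ u =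
          bound (S u) (Vec.lookup X u) (e ℕ.≤? card (outIn u)) (degree≤n u) (degree≤ u)
          where
          bound : ∀ {c s} a b (e≤c? : Dec (e ≤ c)) → s ≤ n → s ≤ c + e →
                  (if a ∨ b then s else 0) ≤ (e + e) + n * (⟦ a ∧ does e≤c? ⟧ + ⟦ b ⟧)
          bound false false _        s≤n s≤c+e = z≤n
          bound false true  _        s≤n s≤c+e =
            ℕ.≤-trans s≤n (ℕ.≤-trans (ℕ.m≤m*n n 1) (ℕ.m≤n+m _ (e + e)))
          bound true  b     (yes _)  s≤n s≤c+e =
            ℕ.≤-trans s≤n (ℕ.≤-trans (ℕ.m≤m*n n (1 + ⟦ b ⟧)) (ℕ.m≤n+m _ (e + e)))
          bound true  b     (no e≰c) s≤n s≤c+e =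
            ℕ.≤-trans s≤c+e (ℕ.≤-trans (ℕ.+-monoˡ-≤ e (ℕ.<⇒≤ (ℕ.≰⇒> e≰c))) (ℕ.m≤m+n (e + e) _))

        edges≤ : edgesIn G S′ ≤ 4 * e * n
        edges≤ = begin
          edgesIn G S′                                           ≤⟨ ∑-mono contribution (allFin n) ⟩
          ∑ (λ u → (e + e) + n * exceptional u) (allFin n)       ≡⟨ ∑-+ (λ _ → e + e) _ (allFin n) ⟩
          ∑ (λ _ → e + e) (allFin n) + ∑ (λ u → n * exceptional u) (allFin n)
                                                                 ≡⟨ cong₂ _+_ (∑-const (e + e) (allFin n)) (∑-*ˡ n exceptional (allFin n)) ⟩
          length (allFin n) * (e + e) + n * ∑ exceptional (allFin n)
                                                                 ≡⟨ cong₂ (λ l c → l * (e + e) + n * c) (length-allFin n) (∑-+ (⟦_⟧ ∘ heavy) _ (allFin n)) ⟩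
          n * (e + e) + n * (card heavy + card (Vec.lookup X))   ≤⟨ ℕ.+-monoʳ-≤ (n * (e + e)) (ℕ.*-monoʳ-≤ n (ℕ.+-mono-≤ (ℕ.<⇒≤ few) X≤e)) ⟩
          n * (e + e) + n * (e + e)                              ≡⟨ four n e ⟩
          4 * e * n                                              ∎
          where
          exceptional = λ u → ⟦ heavy u ⟧ + ⟦ Vec.lookup X u ⟧
          four : ∀ n e → n * (e + e) + n * (e + e) ≡ 4 * e * n
          four = solve-∀

      result : Rich e 2 (λ zs → TrSet G r zs × All (λ z → S z ≡ true) zs)
      result with e ℕ.≤? card heavy
      ... | no e≰  = ⊥-elim (few⇒⊥ (ℕ.≰⇒> e≰))
      ... | yes e≤ = node heavy e≤ λ u u∈ → node (outIn u) (proj₂ (fromHeavy u u∈)) λ v v∈ →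
        leaf ((u ∷ v ∷ [] , ↭-refl , (proj₂ (∧-true⁻ {S v} v∈) ∷ []) ∷ [] ∷ [])
             , proj₁ (fromHeavy u u∈) ∷ proj₁ (∧-true⁻ v∈) ∷ [])

    -- The hypothesis is |S| ≥ (j + 1)(n + e)/r - e. Intersecting with `N v` costs at most (n +
    -- e)/r, which lowers `j` by one, and at j = 0 the set is still large enough for `richEdges`.
    richTr : ∀ j (S : Fin n → Bool) → suc j * (n + e) ≤ r * (card S + e) →
             Rich e (2 + j) (λ zs → TrSet G r zs × All (λ z → S z ≡ true) zs)
    richTr zero    S le = richEdges S (ℕ.≤-trans (ℕ.≤-reflexive (sym (ℕ.*-identityˡ (n + e)))) le)
    richTr (suc j) S le = node S (e≤card S (ℕ.≤-trans (ℕ.m≤m+n (n + e) _) le)) λ v v∈ →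
      Rich-map (λ zs _ (tr , inside) →
          TrSet-∷ tr (All.map (λ {z} z∈ → proj₂ (∧-true⁻ {S z} z∈)) inside)
        , v∈ ∷ All.map (λ z∈ → proj₁ (∧-true⁻ z∈)) inside)
        (richTr j (S∩N v) (step v))
      where
      open ℕ.≤-Reasoning
      S∩N : Fin n → Fin n → Bool
      S∩N v z = S z ∧ N v z
      step : ∀ v → suc j * (n + e) ≤ r * (card (S∩N v) + e)
      step v = ℕ.+-cancelʳ-≤ (r * n + (n + e)) _ _ (begin
        suc j * (n + e) + (r * n + (n + e))                ≡⟨ lhs j n e r ⟩
        suc (suc j) * (n + e) + r * n                      ≤⟨ ℕ.+-mono-≤ le (large v) ⟩
        r * (card S + e) + (r * card (N v) + (n + e))      ≡⟨ mid r (card S) (card (N v)) e n ⟩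
        r * (card S + card (N v)) + (r * e + (n + e))      ≤⟨ ℕ.+-monoˡ-≤ _ (ℕ.*-monoʳ-≤ r (card-∧ S (N v))) ⟩
        r * (card (S∩N v) + n) + (r * e + (n + e))         ≡⟨ rhs r (card (S∩N v)) e n ⟩
        r * (card (S∩N v) + e) + (r * n + (n + e))         ∎)
        where
        lhs : ∀ j n e r → suc j * (n + e) + (r * n + (n + e)) ≡ suc (suc j) * (n + e) + r * n
        lhs = solve-∀
        mid : ∀ r a b e n → r * (a + e) + (r * b + (n + e)) ≡ r * (a + b) + (r * e + (n + e))
        mid = solve-∀
        rhs : ∀ r a e n → r * (a + n) + (r * e + (n + e)) ≡ r * (a + e) + (r * n + (n + e))
        rhs = solve-∀

    richLink : ∀ x y → Rich e (2 + t) (λ zs → TrSet G r (x ∷ zs) × TrSet G r (y ∷ zs))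
    richLink x y = Rich-map (λ zs _ (tr , inside) →
          TrSet-∷ tr (All.map (λ z∈ → proj₁ (∧-true⁻ z∈)) inside)
        , TrSet-∷ tr (All.map (λ {z} z∈ → proj₂ (∧-true⁻ {N x z} z∈)) inside))
      -- The common part of `N x` and `N y` has at least (1 - 2/r)n - 2e/r vertices. This equals (r
      -- - 2)(n + e)/r - e, exactly the threshold of `richTr` for r - 1 vertices.
      (richTr t common (ℕ.+-cancelʳ-≤ (r * n + 2 * (n + e)) _ _ (begin
        suc t * (n + e) + (r * n + 2 * (n + e))            ≡⟨ lhs t n e r ⟩
        (3 + t) * (n + e) + r * n                          ≡⟨ cong (λ s → s * (n + e) + r * n) r≡3+t ⟨
        r * (n + e) + r * n                                ≡⟨ cong (_+ r * n) (ℕ.*-distribˡ-+ r n e) ⟩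
        r * n + r * e + r * n                              ≤⟨ ℕ.+-mono-≤ (ℕ.+-monoˡ-≤ (r * e) (large x)) (large y) ⟩
        r * card (N x) + (n + e) + r * e + (r * card (N y) + (n + e))
                                                           ≡⟨ mid r (card (N x)) (card (N y)) e n ⟩
        r * (card (N x) + card (N y)) + (r * e + 2 * (n + e)) ≤⟨ ℕ.+-monoˡ-≤ _ (ℕ.*-monoʳ-≤ r (card-∧ (N x) (N y))) ⟩
        r * (card common + n) + (r * e + 2 * (n + e))      ≡⟨ rhs r (card common) e n ⟩
        r * (card common + e) + (r * n + 2 * (n + e))      ∎)))
      where
      open ℕ.≤-Reasoning
      common = λ z → N x z ∧ N y z
      lhs : ∀ t n e r → suc t * (n + e) + (r * n + 2 * (n + e)) ≡ (3 + t) * (n + e) + r * n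
      lhs = solve-∀
      mid : ∀ r a b e n → r * a + (n + e) + r * e + (r * b + (n + e)) ≡ r * (a + b) + (r * e + 2 * (n + e))
      mid = solve-∀
      rhs : ∀ r a e n → r * (a + n) + (r * e + 2 * (n + e)) ≡ r * (a + e) + (r * n + 2 * (n + e))
      rhs = solve-∀

    richCopy : Rich e r (TrSet G r)
    richCopy = subst (λ k → Rich e k (TrSet G r)) (sym r≡3+t)
      (Rich-map (λ _ _ → proj₁) (richTr (suc t) (λ _ → true) le))
      where
      open ℕ.≤-Reasoning
      full : card {n} (λ _ → true) ≡ n
      full = trans (∑-const 1 (allFin n)) (trans (ℕ.*-identityʳ _) (length-allFin n))
      le : suc (suc t) * (n + e) ≤ r * (card {n} (λ _ → true) + e)
      le = begin
        suc (suc t) * (n + e)              ≤⟨ ℕ.m≤n+m _ (n + e) ⟩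
        (3 + t) * (n + e)                  ≡⟨ cong₂ (λ s m → s * (m + e)) r≡3+t full ⟨
        r * (card {n} (λ _ → true) + e)    ∎

    -- The links are chosen independently and may overlap; `Rich-avoid` separates them when an
    -- absorber is selected.
    richLinks : ∀ ps qs → length ps ≡ length qs →
                Rich e (length ps * (2 + t)) (λ zs → Packable G r (ps ++ zs) × Packable G r (qs ++ zs))
    richLinks []       []       _   = leaf (Packable-[] G r , Packable-[] G r)
    richLinks (p ∷ ps) (q ∷ qs) len = Rich-bind (richLink p q) λ vs lenᵥ (trₚ , tr) →
      Rich-map (λ zs _ (packₚ , pack) → insert p vs ps zs lenᵥ trₚ packₚ , insert q vs qs zs lenᵥ tr pack)
        (richLinks ps qs (ℕ.suc-injective len))
      where
      insert : ∀ p vs ps zs → length vs ≡ 2 + t → TrSet G r (p ∷ vs) → Packable G r (ps ++ zs) →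
               Packable G r (p ∷ ps ++ (vs ++ zs))
      insert p vs ps zs lenᵥ tr pack =
        Packable-↭ G r (prep p (Perm.shifts vs ps))
          (Packable-++ G r (TrSet⇒Packable G r tr (trans (cong suc lenᵥ) (sym r≡3+t))) pack)

    -- A consists of a copy of T_r on ps and, for each i, a common (r - 1)-link of
    -- p_i and q_i.  In A each link is completed by its p_i; in A ++ Q it is completed by
    -- its q_i, and ps is a copy by itself.
    richAbsorber : ∀ Q → length Q ≡ r →
                   Rich e (r + r * (2 + t)) (λ A → Packable G r A × Packable G r (A ++ Q))
    richAbsorber Q lenQ = Rich-bind richCopy λ ps lenₚ tr →
      Rich-map (λ zs _ (packₚ , pack) → packₚ ,
          Packable-↭ G r (↭-trans (Perm.++⁺ˡ ps (Perm.++-comm Q zs)) (↭-reflexive (sym (List.++-assoc ps zs Q))))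
            (Packable-++ G r (TrSet⇒Packable G r tr lenₚ) pack))
        (subst (λ l → Rich e (l * (2 + t)) (λ zs → Packable G r (ps ++ zs) × Packable G r (Q ++ zs))) lenₚ (richLinks ps Q (trans lenₚ (sym lenQ))))

  -- Families of absorbers

  -- `skip` does not assert that `P` fails, so `h` is a lower bound for the number of entries
  -- satisfying `P`.
  data Hits (P : A → Set) : List A → ℕ → Set where
    none : Hits P [] 0
    hit  : ∀ {a F h} → P a → Hits P F h → Hits P (a ∷ F) (suc h)
    skip : ∀ {a F h} → Hits P F h → Hits P (a ∷ F) h

  Hits-split : ∀ {P : A → Set} {F h} → Hits P F (suc h) →
               ∃[ F₁ ] ∃[ a ] ∃[ F₂ ] F ≡ F₁ ++ a ∷ F₂ × P a
  Hits-split (hit p _) = [] , _ , _ , refl , p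
  Hits-split (skip hs) with Hits-split hs
  ... | F₁ , a , F₂ , refl , p = _ ∷ F₁ , a , F₂ , refl , p

  Hits-remove : ∀ {P : A → Set} F₁ {a F₂ h} → Hits P (F₁ ++ a ∷ F₂) h →
                ∃[ h′ ] h ≤ suc h′ × Hits P (F₁ ++ F₂) h′
  Hits-remove []       (hit _ hs) = _ , ℕ.≤-refl , hs
  Hits-remove []       (skip hs)  = _ , ℕ.n≤1+n _ , hs
  Hits-remove (_ ∷ F₁) (hit p hs) with Hits-remove F₁ hs
  ... | h′ , h≤ , hs′ = suc h′ , s≤s h≤ , hit p hs′
  Hits-remove (_ ∷ F₁) (skip hs) with Hits-remove F₁ hs
  ... | h′ , h≤ , hs′ = h′ , h≤ , skip hs′

  Packable-concat : ∀ (G : Digraph n) r {F} → All (Packable G r) F → Packable G r (concat F)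
  Packable-concat G r []       = Packable-[] G r
  Packable-concat G r (p ∷ ps) = Packable-++ G r p (Packable-concat G r ps)

  -- Each `Q` uses up one member of the family that absorbs it. This costs every later tuple at most
  -- one hit while one tuple fewer remains, so the supply never runs out. Members left over are
  -- packed by themselves.
  absorbAll : ∀ (G : Digraph n) r {F} Qs → All (Packable G r) F →
              All (λ Q → ∃[ h ] length Qs ≤ h × Hits (λ A → Packable G r (A ++ Q)) F h) Qs →
              Packable G r (concat F ++ concat Qs)
  absorbAll G r {F} [] packs _ =
    Packable-↭ G r (↭-reflexive (sym (List.++-identityʳ (concat F)))) (Packable-concat G r packs)
  absorbAll G r (Q ∷ Qs) packs ((suc h , _ , hs) ∷ rest) with Hits-split hs
  ... | F₁ , A , F₂ , refl , pack =
    Packable-↭ G r perm (Packable-++ G r pack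
      (absorbAll G r Qs (All.++⁺ (All.++⁻ˡ F₁ packs) (All.tail (All.++⁻ʳ F₁ packs)))
        (All.map shrink rest)))
    where
    shrink : ∀ {Q′} → ∃[ h ] suc (length Qs) ≤ h × Hits (λ A → Packable G r (A ++ Q′)) (F₁ ++ A ∷ F₂) h →
             ∃[ h ] length Qs ≤ h × Hits (λ A → Packable G r (A ++ Q′)) (F₁ ++ F₂) h
    shrink (h , le , hs) with Hits-remove F₁ hs
    ... | h′ , h≤ , hs′ = h′ , s≤s⁻¹ (ℕ.≤-trans le h≤) , hs′
    perm : (A ++ Q) ++ (concat (F₁ ++ F₂) ++ concat Qs) ↭ concat (F₁ ++ A ∷ F₂) ++ (Q ++ concat Qs)
    perm = begin
      (A ++ Q) ++ (f₁₂ ++ qs)              ≡⟨ List.++-assoc A Q _ ⟩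
      A ++ (Q ++ (f₁₂ ++ qs))              ↭⟨ Perm.++⁺ˡ A (Perm.shifts Q f₁₂) ⟩
      A ++ (f₁₂ ++ (Q ++ qs))              ≡⟨ List.++-assoc A f₁₂ _ ⟨
      (A ++ f₁₂) ++ (Q ++ qs)              ≡⟨ cong (λ l → (A ++ l) ++ (Q ++ qs)) (List.concat-++ F₁ F₂) ⟨
      (A ++ (f₁ ++ f₂)) ++ (Q ++ qs)       ↭⟨ Perm.++⁺ʳ (Q ++ qs) (Perm.shifts A f₁) ⟩
      (f₁ ++ (A ++ f₂)) ++ (Q ++ qs)       ≡⟨ cong (_++ (Q ++ qs)) (List.concat-++ F₁ (A ∷ F₂)) ⟩
      concat (F₁ ++ A ∷ F₂) ++ (Q ++ qs)   ∎
      where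
      open PermutationReasoning
      f₁ = concat F₁
      f₂ = concat F₂
      f₁₂ = concat (F₁ ++ F₂)
      qs = concat Qs

  ∑≡0⊎positive : (f : A → ℕ) (xs : List A) → ∑ f xs ≡ 0 ⊎ ∃[ x ] f x ≢ 0
  ∑≡0⊎positive f [] = inj₁ refl
  ∑≡0⊎positive f (x ∷ xs) with f x in eq
  ... | suc _ = inj₂ (x , λ fx≡0 → ℕ.1+n≢0 (trans (sym eq) fx≡0))
  ... | zero  = ∑≡0⊎positive f xs

  -- The left side consists of the first two terms of the binomial expansion of the right side.
  bernoulli : ∀ x j → x ^ suc j + suc j * x ^ j ≤ suc x ^ suc j
  bernoulli x zero    = ℕ.≤-reflexive (base x)
    where
    base : ∀ x → x * 1 + 1 * 1 ≡ suc x * 1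
    base = solve-∀
  bernoulli x (suc j) = begin
    x * x ^ suc j + suc (suc j) * x ^ suc j        ≡⟨⟩
    x * (x * y) + suc (suc j) * (x * y)            ≤⟨ ℕ.m≤m+n _ (suc j * y) ⟩
    x * (x * y) + suc (suc j) * (x * y) + suc j * y ≡⟨ expand x y j ⟩
    suc x * (x * y + suc j * y)                    ≤⟨ ℕ.*-monoʳ-≤ (suc x) (bernoulli x j) ⟩
    suc x * suc x ^ suc j                          ∎
    where
    open ℕ.≤-Reasoning
    y = x ^ j
    expand : ∀ x y j → x * (x * y) + suc (suc j) * (x * y) + suc j * y ≡ suc x * (x * y + suc j * y)
    expand = solve-∀

  -- (1 + 1/x)^(x+1) ≥ 2
  doubling : ∀ x → 2 * x ^ suc x ≤ suc x ^ suc x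
  doubling x = begin
    2 * x ^ suc x                  ≡⟨ cong (x ^ suc x +_) (ℕ.+-identityʳ _) ⟩
    x ^ suc x + x * x ^ x          ≤⟨ ℕ.+-monoʳ-≤ (x ^ suc x) (ℕ.*-monoˡ-≤ (x ^ x) (ℕ.n≤1+n x)) ⟩
    x ^ suc x + suc x * x ^ x      ≤⟨ bernoulli x x ⟩
    suc x ^ suc x                  ∎
    where open ℕ.≤-Reasoning

  *-^-distrib : ∀ a b m → (a * b) ^ m ≡ a ^ m * b ^ m
  *-^-distrib a b zero    = refl
  *-^-distrib a b (suc m) rewrite *-^-distrib a b m = interchange a b (a ^ m) (b ^ m)
    where
    interchange : ∀ a b c d → a * b * (c * d) ≡ a * c * (b * d)
    interchange = solve-∀

  -- m tuples are chosen one after the other.  The weight of an item doubles in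
  -- each round in which it is not hit, so that an item with few hits is heavy;
  -- each round multiplies the total weight by at most (2K - 1)/K, where K = 1 + κ.
  module Family (x₀ : Fin n) (e d k κ : ℕ) .{{_ : NonZero d}} (n^k≤ : n ^ k ≤ suc κ * d ^ k)
    (C : List (Fin n) → Set) (P : A → List (Fin n) → Set)
    (rich : ∀ a → Rich e k (λ vs → C vs × P a vs)) (xs : List A) where

    record State (m : ℕ) : Set where
      field
        family   : List (List (Fin n))
        weight   : A → ℕ
        unique   : Unique (concat family)
        size     : length (concat family) ≤ m * k
        common   : All C family
        -- That is, `weight a` is at least 2^(m - h): at most `h` of the `m` rounds failed to double
        -- it.
        hits     : ∀ a → ∃[ h ] 2 ^ m ≤ weight a * 2 ^ h × Hits (P a) family h
        total    : suc κ ^ m * ∑ weight xs ≤ (1 + 2 * κ) ^ m * length xs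

    start : State 0
    start = record
      { family = []
      ; weight = λ _ → 1
      ; unique = []
      ; size   = z≤n
      ; common = []
      ; hits   = λ _ → 0 , ℕ.≤-refl , none
      ; total  = ℕ.≤-reflexive (cong (1 *_) (trans (∑-const 1 xs) (ℕ.*-identityʳ _)))
      }

    next : ∀ {m} → d + suc m * k ≤ e → State m → State (suc m)
    next {m} room st = extended (∑≡0⊎positive w′ xs)
      where
      open State st
      open ℕ.≤-Reasoning
      U = concat family
      Allowed : A → List (Fin n) → Set
      Allowed a vs = (C vs × P a vs) × Unique vs × All (_∉ₗ U) vs
      room′ : d + (length U + k) ≤ e
      room′ = begin
        d + (length U + k)    ≤⟨ ℕ.+-monoʳ-≤ d (ℕ.+-monoˡ-≤ k size) ⟩
        d + (m * k + k)       ≡⟨ cong (d +_) (ℕ.+-comm (m * k) k) ⟩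
        d + suc m * k         ≤⟨ room ⟩
        e                     ∎
      choice = choose k xs weight {Allowed} x₀ (λ a → inj₂ (Rich-avoid U room′ (rich a)))
      vs = proj₁ choice
      w′ = proj₁ (proj₂ choice)
      struck : ∀ a → w′ a ≡ 0 ⊎ (w′ a ≡ weight a × Allowed a vs)
      struck = proj₁ (proj₂ (proj₂ choice))
      lenᵥ : length vs ≡ k
      lenᵥ = proj₁ (proj₂ (proj₂ (proj₂ choice)))
      w′≤w : ∀ a → w′ a ≤ weight a
      w′≤w a with struck a
      ... | inj₁ w′≡0 = ℕ.≤-trans (ℕ.≤-reflexive w′≡0) z≤n
      ... | inj₂ (w′≡w , _) = ℕ.≤-reflexive w′≡w
      -- Where `w′ a` equals `weight a` the weight stays; where `w′ a` is 0 it doubles.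
      w⁺ : A → ℕ
      w⁺ a = weight a + (weight a ∸ w′ a)

      ∑w≤ : ∑ weight xs ≤ suc κ * ∑ w′ xs
      ∑w≤ = ℕ.*-cancelˡ-≤ (d ^ k) {{ℕ.m^n≢0 d k}} (begin
        d ^ k * ∑ weight xs            ≤⟨ proj₂ (proj₂ (proj₂ (proj₂ choice))) ⟩
        n ^ k * ∑ w′ xs                ≤⟨ ℕ.*-monoˡ-≤ (∑ w′ xs) n^k≤ ⟩
        suc κ * d ^ k * ∑ w′ xs        ≡⟨ swap (suc κ) (d ^ k) (∑ w′ xs) ⟩
        d ^ k * (suc κ * ∑ w′ xs)      ∎)
        where
        swap : ∀ a b c → a * b * c ≡ b * (a * c)
        swap = solve-∀

      ∑w⁺ : ∑ w⁺ xs + ∑ w′ xs ≡ ∑ weight xs + ∑ weight xs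
      ∑w⁺ = begin-equality
        ∑ w⁺ xs + ∑ w′ xs              ≡⟨ ∑-+ w⁺ w′ xs ⟨
        ∑ (λ a → w⁺ a + w′ a) xs       ≡⟨ ∑-cong (λ a → trans (ℕ.+-assoc (weight a) _ (w′ a)) (cong (weight a +_) (ℕ.m∸n+n≡m (w′≤w a)))) xs ⟩
        ∑ (λ a → weight a + weight a) xs ≡⟨ ∑-+ weight weight xs ⟩
        ∑ weight xs + ∑ weight xs      ∎

      -- The new total is 2W - W′, where the surviving weight W′ is at least W / K. Adding W to both
      -- sides avoids the subtraction.
      decay : suc κ * ∑ w⁺ xs ≤ (1 + 2 * κ) * ∑ weight xs
      decay = ℕ.+-cancelʳ-≤ (∑ weight xs) _ _ (begin
        suc κ * ∑ w⁺ xs + ∑ weight xs                ≤⟨ ℕ.+-monoʳ-≤ _ ∑w≤ ⟩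
        suc κ * ∑ w⁺ xs + suc κ * ∑ w′ xs            ≡⟨ ℕ.*-distribˡ-+ (suc κ) (∑ w⁺ xs) (∑ w′ xs) ⟨
        suc κ * (∑ w⁺ xs + ∑ w′ xs)                  ≡⟨ cong (suc κ *_) ∑w⁺ ⟩
        suc κ * (∑ weight xs + ∑ weight xs)          ≡⟨ regroup κ (∑ weight xs) ⟩
        (1 + 2 * κ) * ∑ weight xs + ∑ weight xs      ∎)
        where
        regroup : ∀ κ W → suc κ * (W + W) ≡ (1 + 2 * κ) * W + W
        regroup = solve-∀

      total⁺ : suc κ ^ suc m * ∑ w⁺ xs ≤ (1 + 2 * κ) ^ suc m * length xs
      total⁺ = begin
        suc κ * suc κ ^ m * ∑ w⁺ xs                  ≡⟨ swap (suc κ) (suc κ ^ m) (∑ w⁺ xs) ⟩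
        suc κ ^ m * (suc κ * ∑ w⁺ xs)                ≤⟨ ℕ.*-monoʳ-≤ (suc κ ^ m) decay ⟩
        suc κ ^ m * ((1 + 2 * κ) * ∑ weight xs)      ≡⟨ swap (1 + 2 * κ) (suc κ ^ m) (∑ weight xs) ⟨
        (1 + 2 * κ) * suc κ ^ m * ∑ weight xs        ≡⟨ ℕ.*-assoc (1 + 2 * κ) (suc κ ^ m) _ ⟩
        (1 + 2 * κ) * (suc κ ^ m * ∑ weight xs)      ≤⟨ ℕ.*-monoʳ-≤ (1 + 2 * κ) total ⟩
        (1 + 2 * κ) * ((1 + 2 * κ) ^ m * length xs)  ≡⟨ ℕ.*-assoc (1 + 2 * κ) ((1 + 2 * κ) ^ m) _ ⟨
        (1 + 2 * κ) ^ suc m * length xs              ∎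
        where
        swap : ∀ a b c → a * b * c ≡ b * (a * c)
        swap = solve-∀

      doubled : ∀ {w h p} → p ≤ w * 2 ^ h → 2 * p ≤ (w + w) * 2 ^ h
      doubled {w} {h} {p} le = ℕ.≤-trans (ℕ.*-monoʳ-≤ 2 le) (ℕ.≤-reflexive (double w (2 ^ h)))
        where
        double : ∀ a b → 2 * (a * b) ≡ (a + a) * b
        double = solve-∀

      -- Without a hit nothing is known about vs, which is then discarded.
      extended : ∑ w′ xs ≡ 0 ⊎ ∃[ a ] w′ a ≢ 0 → State (suc m)
      extended (inj₁ ∑w′≡0) = record
        { family = family
        -- An item outside `xs` may have nonzero `w′`, yet it is not hit by the discarded tuple. So
        -- every weight is doubled; on `xs` this has the same sum as `w⁺`.
        ; weight = λ a → weight a + weight a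
        ; unique = unique
        ; size   = ℕ.≤-trans size (ℕ.m≤n+m _ k)
        ; common = common
        ; hits   = λ a → let (h , le , hs) = hits a in h , doubled {weight a} {h} le , hs
        ; total  = subst (λ W → suc κ ^ suc m * W ≤ (1 + 2 * κ) ^ suc m * length xs) same total⁺
        }
        where
        same : ∑ w⁺ xs ≡ ∑ (λ a → weight a + weight a) xs
        same = begin-equality
          ∑ w⁺ xs                        ≡⟨ ℕ.+-identityʳ _ ⟨
          ∑ w⁺ xs + 0                    ≡⟨ cong (∑ w⁺ xs +_) ∑w′≡0 ⟨
          ∑ w⁺ xs + ∑ w′ xs              ≡⟨ ∑w⁺ ⟩
          ∑ weight xs + ∑ weight xs      ≡⟨ ∑-+ weight weight xs ⟨
          ∑ (λ a → weight a + weight a) xs ∎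
      -- A single struck item certifies that `vs` satisfies `C`, has distinct entries and is
      -- disjoint from `U`, as all this is part of `Allowed a₀`.
      extended (inj₂ (a₀ , w′≢0)) with struck a₀
      ... | inj₁ w′≡0 = ⊥-elim (w′≢0 w′≡0)
      ... | inj₂ (_ , (c , _) , uniqueᵥ , avoids) = record
        { family = vs ∷ family
        ; weight = w⁺
        ; unique = AllPairs.++⁺ uniqueᵥ unique
            (All.map (λ v∉U → All.tabulate (λ u∈U v≡u → v∉U (subst (_∈ₗ U) (sym v≡u) u∈U))) avoids)
        ; size   = ℕ.≤-trans (ℕ.≤-reflexive (List.length-++ vs)) (ℕ.+-mono-≤ (ℕ.≤-reflexive lenᵥ) size)
        ; common = c ∷ common
        ; hits   = hits⁺
        ; total  = total⁺
        }
        where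
        hits⁺ : ∀ a → ∃[ h ] 2 ^ suc m ≤ w⁺ a * 2 ^ h × Hits (P a) (vs ∷ family) h
        hits⁺ a with struck a | hits a
        ... | inj₁ w′≡0 | h , le , hs =
          h , subst (λ x → 2 ^ suc m ≤ (weight a + (weight a ∸ x)) * 2 ^ h) (sym w′≡0) (doubled {weight a} {h} le) , skip hs
        ... | inj₂ (_ , (_ , p) , _) | h , le , hs = suc h , (begin
          2 * 2 ^ m                       ≤⟨ ℕ.*-monoʳ-≤ 2 le ⟩
          2 * (weight a * 2 ^ h)          ≡⟨ swap 2 (weight a) (2 ^ h) ⟩
          weight a * (2 * 2 ^ h)          ≤⟨ ℕ.*-monoˡ-≤ (2 ^ suc h) (ℕ.m≤m+n (weight a) _) ⟩
          w⁺ a * 2 ^ suc h                ∎) , hit p hs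
          where
          swap : ∀ a b c → a * (b * c) ≡ b * (a * c)
          swap = solve-∀

    iterate : ∀ m → d + m * k ≤ e → State m
    iterate zero    room = start
    iterate (suc m) room =
      next room (iterate m (ℕ.≤-trans (ℕ.+-monoʳ-≤ d (ℕ.m≤n+m (m * k) k)) room))

    -- With m = 2K · 2s rounds, `doubling` at 2K - 1 gives (2K/(2K - 1))^m ≥ 4^s.
    rounds : ℕ → ℕ
    rounds s = (2 + 2 * κ) * (2 * s)

    -- The weight of `a` is at least 2^(m - h) and at most the total, which is at most ((2K -
    -- 1)/K)^m · 2^s. By the choice of `rounds` this forces 4^s ≤ 2^(s + h): one factor 2^s pays for
    -- the number of items, the other gives s ≤ h.
    manyHits : ∀ s → length xs ≤ 2 ^ s → (st : State (rounds s)) → ∀ {a} → a ∈ₗ xs →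
               s ≤ proj₁ (State.hits st a)
    manyHits s few st {a} a∈ = ℕ.≮⇒≥ λ h<s → ℕ.<⇒≱ (ℕ.^-monoʳ-< 2 (s≤s (s≤s z≤n)) h<s) 2^s≤2^h
      where
      open State st
      open ℕ.≤-Reasoning
      h = proj₁ (hits a)
      c = 1 + 2 * κ
      m = rounds s
      suc-c : suc κ * 2 ≡ suc c
      suc-c = identity κ
        where
        identity : ∀ κ → suc κ * 2 ≡ suc (1 + 2 * κ)
        identity = solve-∀
      gain : 2 ^ s * 2 ^ s * c ^ m ≤ suc c ^ m
      gain = begin
        2 ^ s * 2 ^ s * c ^ m              ≡⟨ cong (_* c ^ m) (trans (sym (ℕ.^-distribˡ-+-* 2 s s)) (cong (λ u → 2 ^ (s + u)) (sym (ℕ.+-identityʳ s)))) ⟩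
        2 ^ (2 * s) * c ^ m                ≡⟨ cong (2 ^ (2 * s) *_) (ℕ.^-*-assoc c (suc c) (2 * s)) ⟨
        2 ^ (2 * s) * (c ^ suc c) ^ (2 * s) ≡⟨ *-^-distrib 2 (c ^ suc c) (2 * s) ⟨
        (2 * c ^ suc c) ^ (2 * s)          ≤⟨ ℕ.^-monoˡ-≤ (2 * s) (doubling c) ⟩
        (suc c ^ suc c) ^ (2 * s)          ≡⟨ ℕ.^-*-assoc (suc c) (suc c) (2 * s) ⟩
        suc c ^ m                          ∎
      2^s≤2^h : 2 ^ s ≤ 2 ^ h
      2^s≤2^h = ℕ.*-cancelʳ-≤ _ _ (2 ^ s * c ^ m) {{ℕ.m*n≢0 (2 ^ s) (c ^ m) {{ℕ.m^n≢0 2 s}} {{ℕ.m^n≢0 c m}}}} (begin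
        2 ^ s * (2 ^ s * c ^ m)            ≡⟨ ℕ.*-assoc (2 ^ s) (2 ^ s) _ ⟨
        2 ^ s * 2 ^ s * c ^ m              ≤⟨ gain ⟩
        suc c ^ m                          ≡⟨ cong (_^ m) suc-c ⟨
        (suc κ * 2) ^ m                    ≡⟨ *-^-distrib (suc κ) 2 m ⟩
        suc κ ^ m * 2 ^ m                  ≤⟨ ℕ.*-monoʳ-≤ (suc κ ^ m) (proj₁ (proj₂ (hits a))) ⟩
        suc κ ^ m * (weight a * 2 ^ h)     ≡⟨ ℕ.*-assoc (suc κ ^ m) (weight a) _ ⟨
        suc κ ^ m * weight a * 2 ^ h       ≤⟨ ℕ.*-monoˡ-≤ (2 ^ h) (ℕ.*-monoʳ-≤ (suc κ ^ m) (≤∑ weight a∈)) ⟩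
        suc κ ^ m * ∑ weight xs * 2 ^ h    ≤⟨ ℕ.*-monoˡ-≤ (2 ^ h) total ⟩
        c ^ m * length xs * 2 ^ h          ≤⟨ ℕ.*-monoˡ-≤ (2 ^ h) (ℕ.*-monoʳ-≤ (c ^ m) few) ⟩
        c ^ m * 2 ^ s * 2 ^ h              ≡⟨ reverse (c ^ m) (2 ^ s) (2 ^ h) ⟩
        2 ^ h * (2 ^ s * c ^ m)            ∎)
        where
        reverse : ∀ a b c → a * b * c ≡ c * (b * a)
        reverse = solve-∀

  -- Packings from lists of copies

  AllPairs-++⁻ : ∀ {R : A → A → Set} xs {ys} → AllPairs R (xs ++ ys) →
                 AllPairs R xs × AllPairs R ys × All (λ x → All (R x) ys) xs
  AllPairs-++⁻ []       ps       = [] , ps , []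
  AllPairs-++⁻ (x ∷ xs) (p ∷ ps) with AllPairs-++⁻ xs ps
  ... | pxs , pys , cross = All.++⁻ˡ xs p ∷ pxs , pys , All.++⁻ʳ xs p ∷ cross

  AllPairs-lookup : ∀ {R : A → A → Set} {xs} → AllPairs R xs →
                    ∀ {i j} → i Fin.< j → R (lookup xs i) (lookup xs j)
  AllPairs-lookup (p ∷ ps) {zero}  {suc j} i<j       = All.lookup p (∈ₗ.∈-lookup j)
  AllPairs-lookup (p ∷ ps) {suc i} {suc j} (s≤s i<j) = AllPairs-lookup ps i<j

  Unique⇒lookup-injective : ∀ {xs : List A} → Unique xs → ∀ i j → lookup xs i ≡ lookup xs j → i ≡ j
  Unique⇒lookup-injective (p ∷ ps) zero    zero    eq = refl
  Unique⇒lookup-injective (p ∷ ps) zero    (suc j) eq = ⊥-elim (All.lookup p (∈ₗ.∈-lookup j) eq)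
  Unique⇒lookup-injective (p ∷ ps) (suc i) zero    eq = ⊥-elim (All.lookup p (∈ₗ.∈-lookup i) (sym eq))
  Unique⇒lookup-injective (p ∷ ps) (suc i) (suc j) eq = cong suc (Unique⇒lookup-injective ps i j eq)

  module _ {r : ℕ} where

    -- A copy has length `r` only propositionally, hence the `cast`; indices are therefore compared
    -- through `toℕ` below.
    entry : (L : List (List A)) → All (λ ys → length ys ≡ r) L → Fin (length L) → Fin r → A
    entry (ys ∷ L) (len ∷ lens) zero    i = lookup ys (Fin.cast (sym len) i)
    entry (ys ∷ L) (len ∷ lens) (suc j) i = entry L lens j i

    entry-∈ : ∀ (L : List (List A)) lens j i → entry L lens j i ∈ₗ concat L
    entry-∈ (ys ∷ L) (len ∷ lens) zero    i = ∈ₗ.∈-++⁺ˡ {xs = ys} (∈ₗ.∈-lookup (Fin.cast (sym len) i))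
    entry-∈ (ys ∷ L) (len ∷ lens) (suc j) i = ∈ₗ.∈-++⁺ʳ ys (entry-∈ L lens j i)

    ∈-entry : ∀ (L : List (List A)) lens {v} → v ∈ₗ concat L → ∃[ j ] ∃[ i ] entry L lens j i ≡ v
    ∈-entry (ys ∷ L) (len ∷ lens) v∈ with ∈ₗ.∈-++⁻ ys v∈
    ... | inj₁ v∈ys = zero , Fin.cast len (Any.index v∈ys) ,
      trans (cong (lookup ys) (Fin.cast-involutive (sym len) len (Any.index v∈ys)))
        (sym (Any.lookup-index v∈ys))
    ... | inj₂ v∈L with ∈-entry L lens v∈L
    ...   | j , i , eq = suc j , i , eq

    entry-injective : ∀ (L : List (List A)) lens → Unique (concat L) → ∀ j j′ i i′ →
                      entry L lens j i ≡ entry L lens j′ i′ → j ≡ j′ × i ≡ i′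
    entry-injective (ys ∷ L) (len ∷ lens) unique j j′ i i′ eq
      with AllPairs-++⁻ ys unique
    ... | uniqueʸ , uniqueᴸ , cross = go j j′ eq
      where
      go : ∀ j j′ → entry (ys ∷ L) (len ∷ lens) j i ≡ entry (ys ∷ L) (len ∷ lens) j′ i′ → j ≡ j′ × i ≡ i′
      go zero zero eq = refl , Fin.toℕ-injective
        (trans (sym (Fin.toℕ-cast (sym len) i))
          (trans (cong toℕ (Unique⇒lookup-injective uniqueʸ _ _ eq)) (Fin.toℕ-cast (sym len) i′)))
      go zero (suc j′) eq =
        ⊥-elim (All.lookup (All.lookup cross (∈ₗ.∈-lookup (Fin.cast (sym len) i))) (entry-∈ L lens j′ i′) eq)
      go (suc j) zero eq =
        ⊥-elim (All.lookup (All.lookup cross (∈ₗ.∈-lookup (Fin.cast (sym len) i′))) (entry-∈ L lens j i) (sym eq))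
      go (suc j) (suc j′) eq with entry-injective L lens uniqueᴸ j j′ i i′ eq
      ... | refl , i≡i′ = refl , i≡i′

  module _ (G : Digraph n) (r : ℕ) where

    entry-IsTrCopy : ∀ L (lens : All (λ ys → length ys ≡ r) L) → All (AllPairs (Edge G r)) L →
                     ∀ j → IsTrCopy G r (entry L lens j)
    entry-IsTrCopy (ys ∷ L) (len ∷ lens) (edges ∷ _) zero = injective , ordered
      where
      ordered : ∀ i j → i Fin.< j → Edge G r (entry (ys ∷ L) (len ∷ lens) zero i) (entry (ys ∷ L) (len ∷ lens) zero j)
      ordered i j i<j = AllPairs-lookup edges
        (subst₂ _<_ (sym (Fin.toℕ-cast (sym len) i)) (sym (Fin.toℕ-cast (sym len) j)) i<j)
      -- A vertex repeated within a copy would carry a loop.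
      distinct : ∀ {x y} → Edge G r x y → x ≢ y
      distinct {x} xy refl with () ← trans (sym xy) (loopless G x)
      injective : ∀ i j → entry (ys ∷ L) (len ∷ lens) zero i ≡ entry (ys ∷ L) (len ∷ lens) zero j → i ≡ j
      injective i j eq = Fin.toℕ-injective
        (trans (sym (Fin.toℕ-cast (sym len) i))
          (trans (cong toℕ (Unique⇒lookup-injective (AllPairs.map distinct edges) _ _ eq)) (Fin.toℕ-cast (sym len) j)))
    entry-IsTrCopy (_ ∷ L) (_ ∷ lens) (_ ∷ edges) (suc j) = entry-IsTrCopy L lens edges j

    -- Uniqueness of `xs` passes through the permutation to `concat L`, and this makes the copies
    -- disjoint.
    Packable⇒PerfectTrPacking : ∀ {S xs} → Packable G r xs → Unique xs →
                                (∀ v → v ∈ S ⇔ v ∈ₗ xs) → PerfectTrPacking G r S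
    Packable⇒PerfectTrPacking (L , copies , L↭xs) unique S⇔xs =
      length L , entry L lens ,
      entry-IsTrCopy L lens (All.map proj₁ copies) ,
      entry-injective L lens (Unique-resp-↭ (↭⇒↭ₛ (↭-sym L↭xs)) unique) ,
      λ v → mk⇔
        (λ v∈S → ∈-entry L lens (Perm.∈-resp-↭ (↭-sym L↭xs) (Equivalence.to (S⇔xs v) v∈S)))
        (λ { (j , i , refl) → Equivalence.from (S⇔xs v) (Perm.∈-resp-↭ L↭xs (entry-∈ L lens j i)) })
      where
      open import Data.List.Relation.Binary.Permutation.Setoid.Properties (setoid (Fin n))
        using (Unique-resp-↭)
      lens = All.map proj₂ copies

  -- Subsets as duplicate-free lists

  toSubset : List (Fin n) → Subset n
  toSubset U = Vec.tabulate (λ v → member v U)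

  ∈-toSubset : ∀ (U : List (Fin n)) v → v ∈ toSubset U ⇔ v ∈ₗ U
  ∈-toSubset U v = mk⇔
    (λ v∈ → member⁻ U (trans (sym (Vec.lookup∘tabulate _ v)) (Vec.[]=⇒lookup v∈)))
    (λ v∈ → Vec.lookup⇒[]= v (toSubset U) (trans (Vec.lookup∘tabulate _ v) (member⁺ v∈)))

  ∣toSubset∣≤length : (U : List (Fin n)) → ∣ toSubset U ∣ ≤ length U
  ∣toSubset∣≤length U = ℕ.≤-trans (ℕ.≤-reflexive (∣tabulate∣≡card (λ v → member v U))) (card-member U)

  elements : (S : Subset n) → ∃[ xs ] Unique xs × length xs ≡ ∣ S ∣ × (∀ v → v ∈ S ⇔ v ∈ₗ xs)
  elements Vec.[] = [] , [] , refl , λ ()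
  elements {suc n} (b Vec.∷ S) with elements S
  ... | xs , unique , len , S⇔xs = prepend b
    where
    sucs = map suc xs
    suc∈ : ∀ {v} → v ∈ S → suc v ∈ₗ sucs
    suc∈ v∈S = ∈ₗ.∈-map⁺ suc (Equivalence.to (S⇔xs _) v∈S)
    ∈suc : ∀ {v} → v ∈ₗ sucs → ∃[ u ] u ∈ S × v ≡ suc u
    ∈suc v∈ with ∈ₗ.∈-map⁻ suc v∈
    ... | u , u∈xs , eq = u , Equivalence.from (S⇔xs u) u∈xs , eq
    lenˢ : length sucs ≡ ∣ S ∣
    lenˢ = trans (List.length-map suc xs) len
    uniqueˢ : Unique sucs
    uniqueˢ = Unique.map⁺ Fin.suc-injective unique
    prepend : ∀ b → ∃[ ys ] Unique ys × length ys ≡ ∣ b Vec.∷ S ∣ × (∀ v → v ∈ (b Vec.∷ S) ⇔ v ∈ₗ ys)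
    prepend true = zero ∷ sucs , All.tabulate zero∉ ∷ uniqueˢ , cong suc lenˢ , λ v → mk⇔ (to v) (from v)
      where
      zero∉ : ∀ {v} → v ∈ₗ sucs → zero ≢ v
      zero∉ v∈ eq with ∈suc v∈
      ... | _ , _ , eq′ with () ← trans eq eq′
      to : ∀ v → v ∈ (true Vec.∷ S) → v ∈ₗ (zero ∷ sucs)
      to zero    _           = here refl
      to (suc v) (Vec.there v∈) = there (suc∈ v∈)
      from : ∀ v → v ∈ₗ (zero ∷ sucs) → v ∈ (true Vec.∷ S)
      from v (here refl) = Vec.here
      from v (there v∈) with ∈suc v∈
      ... | _ , u∈ , refl = Vec.there u∈
    prepend false = sucs , uniqueˢ , lenˢ , λ v → mk⇔ (to v) (from v)
      where
      to : ∀ v → v ∈ (false Vec.∷ S) → v ∈ₗ sucs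
      to (suc v) (Vec.there v∈) = suc∈ v∈
      from : ∀ v → v ∈ₗ sucs → v ∈ (false Vec.∷ S)
      from v v∈ with ∈suc v∈
      ... | _ , u∈ , refl = Vec.there u∈

  -- Tuples of vertices and the absorbing set

  length-cartesianProductWith : ∀ {C : Set} (f : A → B → C) xs ys →
                                length (cartesianProductWith f xs ys) ≡ length xs * length ys
  length-cartesianProductWith f []       ys = refl
  length-cartesianProductWith f (x ∷ xs) ys = trans (List.length-++ (map (f x) ys))
    (cong₂ _+_ (List.length-map (f x) ys) (length-cartesianProductWith f xs ys))

  -- Tuples with repeated entries are kept. They too have absorbers in the sense of `richAbsorber`,
  -- and the count is simply n^r.
  tuples : ∀ n r → List (Vec.Vec (Fin n) r)
  tuples n zero    = Vec.[] ∷ []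
  tuples n (suc r) = cartesianProductWith Vec._∷_ (allFin n) (tuples n r)

  length-tuples : ∀ n r → length (tuples n r) ≡ n ^ r
  length-tuples n zero    = refl
  length-tuples n (suc r) = trans (length-cartesianProductWith Vec._∷_ (allFin n) (tuples n r))
    (cong₂ _*_ (length-allFin n) (length-tuples n r))

  ∈-tuples : ∀ {n r} (q : Vec.Vec (Fin n) r) → q ∈ₗ tuples n r
  ∈-tuples Vec.[]      = here refl
  ∈-tuples (v Vec.∷ q) = ∈ₗ.∈-cartesianProductWith⁺ Vec._∷_ (∈ₗ.∈-allFin v) (∈-tuples q)

  splitVec : ∀ r {m} (xs : List A) → length xs ≡ r + m →
             ∃[ q ] ∃[ ys ] Vec.toList {n = r} q ++ ys ≡ xs × length ys ≡ m
  splitVec zero    xs       len = Vec.[] , xs , refl , len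
  splitVec (suc r) (x ∷ xs) len with splitVec r xs (ℕ.suc-injective len)
  ... | q , ys , refl , lenʸ = x Vec.∷ q , ys , refl , lenʸ

  chunks : ∀ r l (xs : List A) → length xs ≡ l * r →
           ∃[ qs ] concat (map (Vec.toList {n = r}) qs) ≡ xs × length qs ≡ l
  chunks r zero    []  len = [] , refl , refl
  chunks r (suc l) xs len with splitVec r xs len
  ... | q , ys , refl , lenʸ with chunks r l ys lenʸ
  ...   | qs , refl , lenᵠ = q ∷ qs , refl , cong suc lenᵠ

  -- `M` is the union of the family. By `room`, avoiding it always leaves `d` choices for the next
  -- absorber. `W` is cut into ∣W∣/r ≤ s tuples, and each of them has at least `s` absorbers in the
  -- family.
  absorbingSet : ∀ (G : Digraph n) (r e d k κ s : ℕ) .{{_ : NonZero r}} .{{_ : NonZero d}} → Fin n →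
    (∀ Q → length Q ≡ r → Rich e k (λ A → Packable G r A × Packable G r (A ++ Q))) →
    n ^ k ≤ suc κ * d ^ k → d + (2 + 2 * κ) * (2 * s) * k ≤ e → n ^ r ≤ 2 ^ s →
    ∃[ M ] ∣ M ∣ ≤ (2 + 2 * κ) * (2 * s) * k ×
      (∀ W → (∀ x → x ∈ W → x ∉ M) → r ∣ ∣ W ∣ → ∣ W ∣ ≤ s → TrAbsorbing G r M W)
  absorbingSet {n} G r e d k κ s x₀ rich n^k≤ room n^r≤ =
    M , ℕ.≤-trans (∣toSubset∣≤length U) size , absorb
    where
    open Family x₀ e d k κ n^k≤ (Packable G r) (λ q A → Packable G r (A ++ Vec.toList q))
      (λ q → rich (Vec.toList q) (Vec.length-toList q)) (tuples n r)
    st = iterate (rounds s) room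
    open State st
    U = concat family
    M = toSubset U
    absorb : ∀ W → (∀ x → x ∈ W → x ∉ M) → r ∣ ∣ W ∣ → ∣ W ∣ ≤ s → TrAbsorbing G r M W
    absorb W W∩M≡∅ (divides l ∣W∣≡) ∣W∣≤s
      with xs , uniqueˣ , lenˣ , W⇔xs ← elements W
      with qs , concat≡ , lenᵠ ← chunks r l xs (trans lenˣ ∣W∣≡)
      = Packable⇒PerfectTrPacking G r (Packable-concat G r common) unique (∈-toSubset U)
      , Packable⇒PerfectTrPacking G r
          (subst (λ ys → Packable G r (U ++ ys)) concat≡
            (absorbAll G r (map Vec.toList qs) common (All.map⁺ (All.tabulate available))))
          (AllPairs.++⁺ unique uniqueˣ (All.tabulate λ u∈U → All.tabulate λ x∈xs u≡x → separate u∈U x∈xs u≡x))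
          (λ v → mk⇔
            (λ v∈ → to v (x∈p∪q⁻ M W v∈))
            (λ v∈ → x∈p∪q⁺ (from v (∈ₗ.∈-++⁻ U v∈))))
      where
      available : ∀ {q} → q ∈ₗ qs →
                  ∃[ h ] length (map Vec.toList qs) ≤ h × Hits (λ A → Packable G r (A ++ Vec.toList q)) family h
      available {q} _ with hits q | manyHits s (ℕ.≤-trans (ℕ.≤-reflexive (length-tuples n r)) n^r≤) st (∈-tuples q)
      ... | h , _ , hs | s≤h = h , (begin
        length (map Vec.toList qs)   ≡⟨ trans (List.length-map Vec.toList qs) lenᵠ ⟩
        l                            ≤⟨ ℕ.m≤m*n l r ⟩
        l * r                        ≡⟨ ∣W∣≡ ⟨
        ∣ W ∣                        ≤⟨ ∣W∣≤s ⟩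
        s                            ≤⟨ s≤h ⟩
        h                            ∎) , hs
        where open ℕ.≤-Reasoning
      separate : ∀ {u x} → u ∈ₗ U → x ∈ₗ xs → u ≢ x
      separate {u} u∈U x∈xs refl =
        W∩M≡∅ u (Equivalence.from (W⇔xs u) x∈xs) (Equivalence.from (∈-toSubset U u) u∈U)
      to : ∀ v → v ∈ M ⊎ v ∈ W → v ∈ₗ U ++ xs
      to v (inj₁ v∈M) = ∈ₗ.∈-++⁺ˡ (Equivalence.to (∈-toSubset U v) v∈M)
      to v (inj₂ v∈W) = ∈ₗ.∈-++⁺ʳ U (Equivalence.to (W⇔xs v) v∈W)
      from : ∀ v → v ∈ₗ U ⊎ v ∈ₗ xs → v ∈ M ⊎ v ∈ W
      from v (inj₁ v∈U)  = inj₁ (Equivalence.from (∈-toSubset U v) v∈U)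
      from v (inj₂ v∈xs) = inj₂ (Equivalence.from (W⇔xs v) v∈xs)

  -- Choice of the constants

  suc-n≤2^n : ∀ n → suc n ≤ 2 ^ n
  suc-n≤2^n zero    = ℕ.≤-refl
  suc-n≤2^n (suc n) = begin
    suc (suc n)        ≤⟨ ℕ.+-monoˡ-≤ (suc n) (s≤s z≤n) ⟩
    suc n + suc n      ≤⟨ ℕ.+-mono-≤ (suc-n≤2^n n) (suc-n≤2^n n) ⟩
    2 ^ n + 2 ^ n      ≡⟨ cong (2 ^ n +_) (ℕ.+-identityʳ (2 ^ n)) ⟨
    2 * 2 ^ n          ∎
    where open ℕ.≤-Reasoning

  n≤d*[1+n/d] : ∀ n d .{{_ : NonZero d}} → n ≤ d * suc (n / d)
  n≤d*[1+n/d] n d = begin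
    n                       ≡⟨ m≡m%n+[m/n]*n n d ⟩
    n % d + n / d * d       ≤⟨ ℕ.+-monoˡ-≤ (n / d * d) (m%n≤n n d) ⟩
    d + n / d * d           ≡⟨ ℕ.*-comm (suc (n / d)) d ⟩
    d * suc (n / d)         ∎
    where open ℕ.≤-Reasoning

  -- Let u be the integer part of s / 2r. For u ≥ 4cr, c(s + 1) ≤ 4cr(u + 1) ≤ (u + 1)² ≤ 2^(2u),
  -- and the r-th power of this is at most 2^s.
  polynomial≤exponential : ∀ c r .{{_ : NonZero r}} → ∃[ s₀ ] (∀ s → s₀ ≤ s → (c * suc s) ^ r ≤ 2 ^ s)
  polynomial≤exponential c r@(suc _) = c * (2 * R) * R , bound
    where
    open ℕ.≤-Reasoning
    R = 2 * r
    bound : ∀ s → c * (2 * R) * R ≤ s → (c * suc s) ^ r ≤ 2 ^ s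
    bound s s₀≤s = begin
      (c * suc s) ^ r              ≤⟨ ℕ.^-monoˡ-≤ r base≤ ⟩
      (2 ^ u * 2 ^ u) ^ r          ≡⟨ cong (_^ r) (ℕ.^-distribˡ-+-* 2 u u) ⟨
      (2 ^ (u + u)) ^ r            ≡⟨ ℕ.^-*-assoc 2 (u + u) r ⟩
      2 ^ ((u + u) * r)            ≤⟨ ℕ.^-monoʳ-≤ 2 (ℕ.≤-trans (ℕ.≤-reflexive (twice u r)) (m/n*n≤m s R)) ⟩
      2 ^ s                        ∎
      where
      u = s / R
      twice : ∀ u r → (u + u) * r ≡ u * (2 * r)
      twice = solve-∀
      regroup : ∀ c R v → c * (2 * R * v) ≡ c * (2 * R) * v
      regroup = solve-∀
      suc-s≤ : suc s ≤ 2 * R * suc u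
      suc-s≤ = begin
        suc s                      ≤⟨ s≤s (n≤d*[1+n/d] s R) ⟩
        1 + R * suc u              ≤⟨ ℕ.+-monoˡ-≤ (R * suc u) (s≤s z≤n) ⟩
        R * suc u + R * suc u      ≡⟨ dbl R (suc u) ⟩
        2 * R * suc u              ∎
        where
        dbl : ∀ R v → R * v + R * v ≡ 2 * R * v
        dbl = solve-∀
      c*2R≤u : c * (2 * R) ≤ u
      c*2R≤u = begin
        c * (2 * R)                ≡⟨ m*n/n≡m (c * (2 * R)) R ⟨
        c * (2 * R) * R / R        ≤⟨ /-monoˡ-≤ R s₀≤s ⟩
        u                          ∎
      base≤ : c * suc s ≤ 2 ^ u * 2 ^ u
      base≤ = begin
        c * suc s                  ≤⟨ ℕ.*-monoʳ-≤ c suc-s≤ ⟩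
        c * (2 * R * suc u)        ≡⟨ regroup c R (suc u) ⟩
        c * (2 * R) * suc u        ≤⟨ ℕ.*-mono-≤ (ℕ.m≤n⇒m≤1+n c*2R≤u) (ℕ.≤-refl {suc u}) ⟩
        suc u * suc u              ≤⟨ ℕ.*-mono-≤ (suc-n≤2^n u) (suc-n≤2^n u) ⟩
        2 ^ u * 2 ^ u              ∎

  -- The result in integer form, with s in the role of ξn / cost. The degree condition reads |N x| ≥
  -- (1 - 1/r - 1/(ratio · r))n, and 1/(1 + g) replaces γ. Stated separately, it lets the rational
  -- estimates treat `ratio` and `cost` as variables.
  Absorption : (r g n₁ ratio cost : ℕ) → Set
  Absorption r g n₁ ratio cost = ∀ {n} (G : Digraph n) s →
    n₁ ≤ n → ratio * (cost * s) ≤ n → n ^ r ≤ 2 ^ s →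
    (N : Fin n → Fin n → Bool) →
    (∀ x → (∀ y → N x y ≡ true → Edge G r x y) ⊎ (∀ y → N x y ≡ true → Edge G r y x)) →
    (∀ x → ratio * (r * n) ≤ ratio * (r * card (N x) + n) + n) →
    (∀ (S : Subset n) → n ≤ r * ∣ S ∣ → n * n < suc g * edgesIn G S) →
    ∃[ M ] ∣ M ∣ ≤ cost * s ×
      (∀ W → (∀ x → x ∈ W → x ∉ M) → r ∣ ∣ W ∣ → ∣ W ∣ ≤ s → TrAbsorbing G r M W)

  module Constants (t g : ℕ) where

    r = 3 + t

    -- the order of an absorber
    k = r + r * (2 + t)

    -- With d = ⌊n / (12(1+g)r)⌋ ≥ 1, at least d choices are left at each of the k steps
    -- in the selection of an absorber, and n ≤ ratio * d.
    ratio = 24 * suc g * r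

    -- Thus 1 + κ = ratio^k is at least (n / d)^k, the reciprocal of the share of weight kept by
    -- `choose`.
    κ = pred (ratio ^ k)

    -- |M| ≤ cost * s when every r-tuple is to have s absorbers
    cost = (2 + 2 * κ) * 2 * k

    absorption : Absorption r g (12 * suc g * r) ratio cost
    absorption {n} G s n≥ cost≤ n^r≤ N oneSided large dense =
      let (M , M≤ , absorbs) = absorbingSet G r e d k κ s x₀ richAbsorber n^k≤ room n^r≤
      in M , ℕ.≤-trans M≤ (ℕ.≤-reflexive costs) , absorbs
      where
      open ℕ.≤-Reasoning
      D = 12 * suc g * r
      d = n / D
      -- The family uses up at most `cost * s` ≤ d vertices and `d` choices must survive, for which
      -- 3d is ample. The 12 in `D` is 4 · 3, from the bound 4en in `dense′`.
      e = 3 * d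
      instance
        d≢0 : NonZero d
        d≢0 = >-nonZero (m≥n⇒m/n>0 {n} {D} n≥)
      x₀ : Fin n
      x₀ = Fin.fromℕ< {0} (ℕ.≤-trans (s≤s z≤n) n≥)
      Dd≤n : D * d ≤ n
      Dd≤n = ℕ.≤-trans (ℕ.≤-reflexive (ℕ.*-comm D d)) (m/n*n≤m n D)
      n≤ratio*d : n ≤ ratio * d
      n≤ratio*d = begin
        n                    ≤⟨ n≤d*[1+n/d] n D ⟩
        D * suc d            ≤⟨ ℕ.*-monoʳ-≤ D (ℕ.+-monoˡ-≤ d (>-nonZero⁻¹ d)) ⟩
        D * (d + d)          ≡⟨ regroup (suc g) r d ⟩
        ratio * d            ∎
        where
        regroup : ∀ g r d → 12 * g * r * (d + d) ≡ 24 * g * r * d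
        regroup = solve-∀
      large′ : ∀ x → r * n ≤ r * card (N x) + (n + e)
      large′ x = ℕ.*-cancelˡ-≤ ratio (begin
        ratio * (r * n)                            ≤⟨ large x ⟩
        ratio * (r * card (N x) + n) + n           ≤⟨ ℕ.+-monoʳ-≤ _ n≤ratio*d ⟩
        ratio * (r * card (N x) + n) + ratio * d   ≡⟨ ℕ.*-distribˡ-+ ratio (r * card (N x) + n) d ⟨
        ratio * (r * card (N x) + n + d)           ≤⟨ ℕ.*-monoʳ-≤ ratio (ℕ.+-monoʳ-≤ (r * card (N x) + n) (ℕ.m≤n*m d 3)) ⟩
        ratio * (r * card (N x) + n + e)           ≡⟨ cong (ratio *_) (ℕ.+-assoc (r * card (N x)) n e) ⟩
        ratio * (r * card (N x) + (n + e))         ∎)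
      dense′ : ∀ (S : Subset n) → n ≤ r * ∣ S ∣ → 4 * e * n < edgesIn G S
      dense′ S le = ℕ.*-cancelˡ-< (suc g) _ _ (begin-strict
        suc g * (4 * e * n)          ≤⟨ ℕ.m≤m*n _ r ⟩
        suc g * (4 * e * n) * r      ≡⟨ regroup (suc g) d n r ⟩
        D * d * n                    ≤⟨ ℕ.*-monoˡ-≤ n Dd≤n ⟩
        n * n                        <⟨ dense S le ⟩
        suc g * edgesIn G S          ∎)
        where
        regroup : ∀ g d n r → g * (4 * (3 * d) * n) * r ≡ 12 * g * r * d * n
        regroup = solve-∀
      small : 2 * (r * e) ≤ n
      small = begin
        2 * (r * e)                  ≡⟨ left r d ⟩
        6 * r * d                    ≤⟨ ℕ.m≤n*m (6 * r * d) (2 * suc g) ⟩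
        2 * suc g * (6 * r * d)      ≡⟨ right (suc g) r d ⟩
        D * d                        ≤⟨ Dd≤n ⟩
        n                            ∎
        where
        left : ∀ r d → 2 * (r * (3 * d)) ≡ 6 * r * d
        left = solve-∀
        right : ∀ g r d → 2 * g * (6 * r * d) ≡ 12 * g * r * d
        right = solve-∀
      open Absorber G t r e refl N oneSided large′ dense′ small using (richAbsorber)
      n^k≤ : n ^ k ≤ suc κ * d ^ k
      n^k≤ = begin
        n ^ k                        ≤⟨ ℕ.^-monoˡ-≤ k n≤ratio*d ⟩
        (ratio * d) ^ k              ≡⟨ *-^-distrib ratio d k ⟩
        ratio ^ k * d ^ k            ≡⟨ cong (_* d ^ k) (ℕ.suc-pred (ratio ^ k) {{ℕ.m^n≢0 ratio k}}) ⟨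
        suc κ * d ^ k                ∎
      costs : (2 + 2 * κ) * (2 * s) * k ≡ cost * s
      costs = regroup (2 + 2 * κ) s k
        where
        regroup : ∀ a s k → a * (2 * s) * k ≡ a * 2 * k * s
        regroup = solve-∀
      room : d + (2 + 2 * κ) * (2 * s) * k ≤ e
      room = begin
        d + (2 + 2 * κ) * (2 * s) * k    ≡⟨ cong (d +_) costs ⟩
        d + cost * s                     ≤⟨ ℕ.+-monoʳ-≤ d (ℕ.*-cancelˡ-≤ ratio (ℕ.≤-trans cost≤ n≤ratio*d)) ⟩
        d + d                            ≤⟨ ℕ.+-monoʳ-≤ d (ℕ.m≤m+n d (d + 0)) ⟩
        e                                ∎

  -- A downward search from `b`; it finds the last place below `b` where `P` holds, without
  -- monotonicity.
  greatest : ∀ {P : ℕ → Set} → (∀ s → Dec (P s)) → P 0 → ∀ b → ¬ P b → ∃[ s ] P s × ¬ P (suc s)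
  greatest P? p₀ zero    ¬p = ⊥-elim (¬p p₀)
  greatest P? p₀ (suc b) ¬p with P? b
  ... | yes p  = b , p , ¬p
  ... | no ¬p′ = greatest P? p₀ b ¬p′

open Combinatorics

import Data.Integer.Base as ℤ
import Data.Integer.Properties as ℤ
import Data.Nat.Base as ℕ
open import Data.Nat using (ℕ; zero; suc; _≥_)
open import Data.Nat.Divisibility using (_∣_)
import Data.Rational.Base as ℚ
import Data.Rational.Properties as ℚ
open import Data.Rational.Solver using (module +-*-Solver)
import Data.Rational.Unnormalised.Base as ℚᵘ
import Data.Rational.Unnormalised.Properties as ℚᵘ
open import Data.Rational using (ℚ; _<_; _≤_; _*_; _-_; 0ℚ; 1ℚ)

-- Rational estimates

-- `toℚ` reduces fractions to lowest terms. Among unnormalised rationals the denominator is visibly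
-- 1, so that order and arithmetic come down to integers.
toℚᵘ-toℚ : ∀ m → ℚ.toℚᵘ (toℚ m) ℚᵘ.≃ ℚᵘ.mkℚᵘ (ℤ.+ m) 0
toℚᵘ-toℚ m = ℚ.toℚᵘ-fromℚᵘ (ℚᵘ.mkℚᵘ (ℤ.+ m) 0)

toℚ-mono-≤ : ∀ {a b} → a ℕ.≤ b → toℚ a ≤ toℚ b
toℚ-mono-≤ {a} {b} a≤b = ℚ.toℚᵘ-cancel-≤
  (ℚᵘ.≤-respˡ-≃ (ℚᵘ.≃-sym (toℚᵘ-toℚ a)) (ℚᵘ.≤-respʳ-≃ (ℚᵘ.≃-sym (toℚᵘ-toℚ b))
    (ℚᵘ.*≤* (ℤ.*-monoʳ-≤-nonNeg (ℤ.+ 1) (ℤ.+≤+ a≤b)))))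

toℚ-cancel-≤ : ∀ {a b} → toℚ a ≤ toℚ b → a ℕ.≤ b
toℚ-cancel-≤ {a} {b} le with ℚᵘ.≤-respˡ-≃ (toℚᵘ-toℚ a) (ℚᵘ.≤-respʳ-≃ (toℚᵘ-toℚ b) (ℚ.toℚᵘ-mono-≤ le))
... | ℚᵘ.*≤* le′ = ℤ.drop‿+≤+ (ℤ.*-cancelʳ-≤-pos (ℤ.+ a) (ℤ.+ b) (ℤ.+ 1) le′)

toℚ-+ : ∀ a b → toℚ (a ℕ.+ b) ≡ toℚ a ℚ.+ toℚ b
toℚ-+ a b = ℚ.toℚᵘ-injective (begin
  ℚ.toℚᵘ (toℚ (a ℕ.+ b))                                 ≈⟨ toℚᵘ-toℚ (a ℕ.+ b) ⟩
  ℚᵘ.mkℚᵘ (ℤ.+ (a ℕ.+ b)) 0                              ≈⟨ ℚᵘ.*≡* (cong (λ m → (ℤ.+ m) ℤ.* ℤ.+ 1) (cong₂ ℕ._+_ (sym (ℕ.*-identityʳ a)) (sym (ℕ.*-identityʳ b)))) ⟩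
  ℚᵘ.mkℚᵘ (ℤ.+ (a ℕ.* 1 ℕ.+ b ℕ.* 1)) 0                  ≈⟨ ℚᵘ.≃-reflexive (cong (λ i → ℚᵘ.mkℚᵘ i 0) (cong₂ ℤ._+_ (ℤ.pos-* a 1) (ℤ.pos-* b 1))) ⟩
  ℚᵘ.mkℚᵘ (ℤ.+ a) 0 ℚᵘ.+ ℚᵘ.mkℚᵘ (ℤ.+ b) 0                ≈⟨ ℚᵘ.+-cong (toℚᵘ-toℚ a) (toℚᵘ-toℚ b) ⟨
  ℚ.toℚᵘ (toℚ a) ℚᵘ.+ ℚ.toℚᵘ (toℚ b)                      ≈⟨ ℚ.toℚᵘ-homo-+ (toℚ a) (toℚ b) ⟨
  ℚ.toℚᵘ (toℚ a ℚ.+ toℚ b)                               ∎)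
  where open ℚᵘ.≃-Reasoning

toℚ-* : ∀ a b → toℚ (a ℕ.* b) ≡ toℚ a * toℚ b
toℚ-* a b = ℚ.toℚᵘ-injective (begin
  ℚ.toℚᵘ (toℚ (a ℕ.* b))                                 ≈⟨ toℚᵘ-toℚ (a ℕ.* b) ⟩
  ℚᵘ.mkℚᵘ (ℤ.+ (a ℕ.* b)) 0                              ≈⟨ ℚᵘ.≃-reflexive (cong (λ i → ℚᵘ.mkℚᵘ i 0) (ℤ.pos-* a b)) ⟩
  ℚᵘ.mkℚᵘ (ℤ.+ a) 0 ℚᵘ.* ℚᵘ.mkℚᵘ (ℤ.+ b) 0                ≈⟨ ℚᵘ.*-cong (toℚᵘ-toℚ a) (toℚᵘ-toℚ b) ⟨
  ℚ.toℚᵘ (toℚ a) ℚᵘ.* ℚ.toℚᵘ (toℚ b)                      ≈⟨ ℚ.toℚᵘ-homo-* (toℚ a) (toℚ b) ⟨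
  ℚ.toℚᵘ (toℚ a * toℚ b)                                 ∎)
  where open ℚᵘ.≃-Reasoning

0≤toℚ : ∀ m → 0ℚ ≤ toℚ m
0≤toℚ m = toℚ-mono-≤ {0} {m} ℕ.z≤n

*-monoˡ : ∀ {c p q} → 0ℚ ≤ c → p ≤ q → c * p ≤ c * q
*-monoˡ {c} 0≤c = ℚ.*-monoˡ-≤-nonNeg c {{ℚ.nonNegative 0≤c}}

*-monoʳ : ∀ {c p q} → 0ℚ ≤ c → p ≤ q → p * c ≤ q * c
*-monoʳ {c} 0≤c = ℚ.*-monoʳ-≤-nonNeg c {{ℚ.nonNegative 0≤c}}

inv-pos : ∀ m .{{_ : ℕ.NonZero m}} → 0ℚ < inv m
inv-pos (suc m) = ℚ.positive⁻¹ (inv (suc m)) {{ℚ.normalize-pos 1 (suc m)}}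

inv-* : ∀ m .{{_ : ℕ.NonZero m}} → inv m * toℚ m ≡ 1ℚ
inv-* (suc m) = ℚ.toℚᵘ-injective (begin
  ℚ.toℚᵘ (inv (suc m) * toℚ (suc m))                     ≈⟨ ℚ.toℚᵘ-homo-* (inv (suc m)) (toℚ (suc m)) ⟩
  ℚ.toℚᵘ (inv (suc m)) ℚᵘ.* ℚ.toℚᵘ (toℚ (suc m))         ≈⟨ ℚᵘ.*-cong (ℚ.toℚᵘ-fromℚᵘ (ℚᵘ.mkℚᵘ (ℤ.+ 1) m)) (toℚᵘ-toℚ (suc m)) ⟩
  ℚᵘ.mkℚᵘ (ℤ.+ 1) m ℚᵘ.* ℚᵘ.mkℚᵘ (ℤ.+ suc m) 0           ≈⟨ ℚᵘ.*≡* (cong (ℤ.+_) (identity m)) ⟩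
  ℚᵘ.1ℚᵘ                                                 ∎)
  where
  open ℚᵘ.≃-Reasoning
  identity : ∀ m → 1 ℕ.* suc m ℕ.* 1 ≡ 1 ℕ.* (suc m ℕ.* 1)
  identity = solve-∀

≤inv⇒*≤1 : ∀ {q} m l .{{_ : ℕ.NonZero m}} → 0ℚ ≤ q → l ℕ.≤ m → q ≤ inv m → q * toℚ l ≤ 1ℚ
≤inv⇒*≤1 {q} m l 0≤q l≤m q≤ = begin
  q * toℚ l          ≤⟨ *-monoˡ 0≤q (toℚ-mono-≤ l≤m) ⟩
  q * toℚ m          ≤⟨ *-monoʳ (0≤toℚ m) q≤ ⟩
  inv m * toℚ m      ≡⟨ inv-* m ⟩
  1ℚ                 ∎
  where open ℚ.≤-Reasoning

-- The denominator of `q`, stored as its predecessor `d`, will do: the product is the numerator,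
-- which is at least 1.
archimedean : ∀ q → 0ℚ < q → ∃[ g ] 1ℚ ≤ q * toℚ (suc g)
archimedean q@(ℚ.mkℚ (ℤ.+ suc p) d _) _ = d , ℚ.toℚᵘ-cancel-≤
  (ℚᵘ.≤-respʳ-≃ (ℚᵘ.≃-sym (ℚᵘ.≃-trans (ℚ.toℚᵘ-homo-* q (toℚ (suc d))) (ℚᵘ.*-congˡ {ℚ.toℚᵘ q} (toℚᵘ-toℚ (suc d)))))
    (ℚᵘ.*≤* (ℤ.+≤+ (ℕ.≤-trans (ℕ.m≤n*m _ (suc p)) (ℕ.≤-reflexive (identity p d))))))
  where
  identity : ∀ p d → suc p ℕ.* (1 ℕ.* (suc d ℕ.* 1)) ≡ suc p ℕ.* suc d ℕ.* 1
  identity = solve-∀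
archimedean (ℚ.mkℚ (ℤ.+ 0) d _) (ℚ.*<* (ℤ.+<+ ()))
archimedean (ℚ.mkℚ ℤ.-[1+ p ] d _) (ℚ.*<* ())

-- Conditions on ξ, ε and γ in integer form

module Rationals (r ratio cost : ℕ) .{{_ : ℕ.NonZero r}} .{{_ : ℕ.NonZero ratio}} .{{_ : ℕ.NonZero cost}} where

  open +-*-Solver using (solve; _:*_; _:+_; _:-_; _:=_; con)
  open ℚ.≤-Reasoning

  -- The factor `ratio` keeps the size of `M` below n / ratio; the factor `2 * cost` brings ξ²n down
  -- to `s`.
  ξ-threshold : ℕ
  ξ-threshold = 2 ℕ.* cost ℕ.* ratio

  instance
    2cost≢0 : ℕ.NonZero (2 ℕ.* cost)
    2cost≢0 = ℕ.m*n≢0 2 cost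

    ξ-threshold≢0 : ℕ.NonZero ξ-threshold
    ξ-threshold≢0 = ℕ.m*n≢0 (2 ℕ.* cost) ratio

    ε-threshold≢0 : ℕ.NonZero (ratio ℕ.* r)
    ε-threshold≢0 = ℕ.m*n≢0 ratio r

  module _ {ξ : ℚ} (0<ξ : 0ℚ < ξ) (ξ≤ : ξ ≤ inv ξ-threshold) where

    0≤ξ : 0ℚ ≤ ξ
    0≤ξ = ℚ.<⇒≤ 0<ξ

    ξ*ratio≤1 : ξ * toℚ ratio ≤ 1ℚ
    ξ*ratio≤1 = ≤inv⇒*≤1 ξ-threshold ratio 0≤ξ (ℕ.m≤n*m ratio (2 ℕ.* cost)) ξ≤

    ξ*2cost≤1 : ξ * toℚ (2 ℕ.* cost) ≤ 1ℚ
    ξ*2cost≤1 = ≤inv⇒*≤1 ξ-threshold (2 ℕ.* cost) 0≤ξ (ℕ.m≤m*n (2 ℕ.* cost) ratio) ξ≤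

    affordable⇒≤n : ∀ n s → toℚ (cost ℕ.* s) ≤ ξ * toℚ n → ratio ℕ.* (cost ℕ.* s) ℕ.≤ n
    affordable⇒≤n n s le = toℚ-cancel-≤ (begin
      toℚ (ratio ℕ.* (cost ℕ.* s))      ≡⟨ toℚ-* ratio (cost ℕ.* s) ⟩
      toℚ ratio * toℚ (cost ℕ.* s)      ≤⟨ *-monoˡ (0≤toℚ ratio) le ⟩
      toℚ ratio * (ξ * toℚ n)           ≡⟨ solve 3 (λ b x m → b :* (x :* m) := x :* b :* m) refl (toℚ ratio) ξ (toℚ n) ⟩
      ξ * toℚ ratio * toℚ n             ≤⟨ *-monoʳ (0≤toℚ n) ξ*ratio≤1 ⟩
      1ℚ * toℚ n                        ≡⟨ ℚ.*-identityˡ (toℚ n) ⟩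
      toℚ n                             ∎)

    -- This `s` is the integer part of ξn / cost. The search may start at n + 1, since affording
    -- that would give n + 1 ≤ n by `affordable⇒≤n`.
    greatestAffordable : ∀ n → ∃[ s ] toℚ (cost ℕ.* s) ≤ ξ * toℚ n × ¬ (toℚ (cost ℕ.* suc s) ≤ ξ * toℚ n)
    greatestAffordable n = greatest (λ s → toℚ (cost ℕ.* s) ℚ.≤? ξ * toℚ n) zeroAffordable (suc n)
      λ le → ℕ.1+n≰n (ℕ.≤-trans (ℕ.≤-trans (ℕ.m≤n*m (suc n) cost) (ℕ.m≤n*m (cost ℕ.* suc n) ratio))
                                (affordable⇒≤n n (suc n) le))
      where
      zeroAffordable : toℚ (cost ℕ.* 0) ≤ ξ * toℚ n
      zeroAffordable = begin
        toℚ (cost ℕ.* 0)     ≡⟨ cong toℚ (ℕ.*-zeroʳ cost) ⟩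
        0ℚ                   ≡⟨ ℚ.*-zeroˡ (toℚ n) ⟨
        0ℚ * toℚ n           ≤⟨ *-monoʳ (0≤toℚ n) 0≤ξ ⟩
        ξ * toℚ n            ∎

    module _ (n s : ℕ) (ξn≤ : ξ * toℚ n ≤ toℚ (cost ℕ.* suc s)) where

      -- So `s` grows linearly with `n`, and `polynomial≤exponential` can supply n^r ≤ 2^s.
      n≤multiple : ∀ z → 1ℚ ≤ ξ * toℚ (suc z) → n ℕ.≤ suc z ℕ.* cost ℕ.* suc s
      n≤multiple z 1≤ξz = toℚ-cancel-≤ (begin
        toℚ n                                    ≡⟨ ℚ.*-identityˡ (toℚ n) ⟨
        1ℚ * toℚ n                               ≤⟨ *-monoʳ (0≤toℚ n) 1≤ξz ⟩
        ξ * toℚ (suc z) * toℚ n                  ≡⟨ solve 3 (λ x y m → x :* y :* m := y :* (x :* m)) refl ξ (toℚ (suc z)) (toℚ n) ⟩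
        toℚ (suc z) * (ξ * toℚ n)                ≤⟨ *-monoˡ (0≤toℚ (suc z)) ξn≤ ⟩
        toℚ (suc z) * toℚ (cost ℕ.* suc s)       ≡⟨ toℚ-* (suc z) (cost ℕ.* suc s) ⟨
        toℚ (suc z ℕ.* (cost ℕ.* suc s))         ≡⟨ cong toℚ (ℕ.*-assoc (suc z) cost (suc s)) ⟨
        toℚ (suc z ℕ.* cost ℕ.* suc s)           ∎)

      -- Here 2w ≤ 2ξ · ξn ≤ 2ξ · cost · (s + 1) ≤ s + 1. The factor 2 bridges the gap between s + 1
      -- and s.
      ξ²n⇒≤s : ∀ w → toℚ w ≤ ξ * ξ * toℚ n → w ℕ.≤ s
      ξ²n⇒≤s w le = halve w (toℚ-cancel-≤ (begin
        toℚ (2 ℕ.* w)                            ≡⟨ toℚ-* 2 w ⟩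
        toℚ 2 * toℚ w                            ≤⟨ *-monoˡ (0≤toℚ 2) le ⟩
        toℚ 2 * (ξ * ξ * toℚ n)                  ≡⟨ solve 3 (λ a x m → a :* (x :* x :* m) := a :* x :* (x :* m)) refl (toℚ 2) ξ (toℚ n) ⟩
        toℚ 2 * ξ * (ξ * toℚ n)                  ≤⟨ ℚ.*-monoˡ-≤-nonNeg (toℚ 2 * ξ) {{ℚ.nonNeg*nonNeg⇒nonNeg (toℚ 2) ξ {{ℚ.nonNegative 0≤ξ}}}} ξn≤ ⟩
        toℚ 2 * ξ * toℚ (cost ℕ.* suc s)         ≡⟨ cong (toℚ 2 * ξ *_) (toℚ-* cost (suc s)) ⟩
        toℚ 2 * ξ * (toℚ cost * toℚ (suc s))     ≡⟨ solve 4 (λ a x c y → a :* x :* (c :* y) := x :* (a :* c) :* y) refl (toℚ 2) ξ (toℚ cost) (toℚ (suc s)) ⟩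
        ξ * (toℚ 2 * toℚ cost) * toℚ (suc s)     ≡⟨ cong (λ c → ξ * c * toℚ (suc s)) (toℚ-* 2 cost) ⟨
        ξ * toℚ (2 ℕ.* cost) * toℚ (suc s)       ≤⟨ *-monoʳ (0≤toℚ (suc s)) ξ*2cost≤1 ⟩
        1ℚ * toℚ (suc s)                         ≡⟨ ℚ.*-identityˡ (toℚ (suc s)) ⟩
        toℚ (suc s)                              ∎))
        where
        halve : ∀ w → 2 ℕ.* w ℕ.≤ suc s → w ℕ.≤ s
        halve zero    _          = ℕ.z≤n
        halve (suc w) (ℕ.s≤s le) = ℕ.≤-trans (ℕ.m≤m+n (suc w) 0) (ℕ.≤-trans (ℕ.m≤n+m (suc w ℕ.+ 0) w) le)

  -- Multiplied by ratio · r, the term n / r becomes ratio · n, and εn becomes at most n.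
  deficiency : ∀ {ε} → 0ℚ < ε → ε ≤ inv (ratio ℕ.* r) → ∀ n c →
               (1ℚ - inv r - ε) * toℚ n ≤ toℚ c → ratio ℕ.* (r ℕ.* n) ℕ.≤ ratio ℕ.* (r ℕ.* c ℕ.+ n) ℕ.+ n
  deficiency {ε} 0<ε ε≤ n c le = toℚ-cancel-≤ (begin
    toℚ (ratio ℕ.* (r ℕ.* n))          ≡⟨ trans (toℚ-* ratio (r ℕ.* n)) (cong (B *_) (toℚ-* r n)) ⟩
    B * (R * N)                        ≡⟨ solve 5 (λ b ρ i x m → b :* (ρ :* m)
                                            := b :* (ρ :* ((con 1ℚ :- i :- x) :* m) :+ i :* ρ :* m) :+ x :* (b :* ρ) :* m)
                                            refl B R (inv r) ε N ⟩
    B * (R * ((1ℚ - inv r - ε) * N) ℚ.+ inv r * R * N) ℚ.+ ε * (B * R) * N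
                                       ≤⟨ ℚ.+-mono-≤ (*-monoˡ (0≤toℚ ratio) (ℚ.+-mono-≤ (*-monoˡ (0≤toℚ r) le) inv≤)) ε≤1 ⟩
    B * (R * toℚ c ℚ.+ N) ℚ.+ N        ≡⟨ cong (λ q → B * (q ℚ.+ N) ℚ.+ N) (toℚ-* r c) ⟨
    B * (toℚ (r ℕ.* c) ℚ.+ N) ℚ.+ N    ≡⟨ cong (λ q → B * q ℚ.+ N) (toℚ-+ (r ℕ.* c) n) ⟨
    B * toℚ (r ℕ.* c ℕ.+ n) ℚ.+ N      ≡⟨ cong (ℚ._+ N) (toℚ-* ratio (r ℕ.* c ℕ.+ n)) ⟨
    toℚ (ratio ℕ.* (r ℕ.* c ℕ.+ n)) ℚ.+ N ≡⟨ toℚ-+ (ratio ℕ.* (r ℕ.* c ℕ.+ n)) n ⟨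
    toℚ (ratio ℕ.* (r ℕ.* c ℕ.+ n) ℕ.+ n) ∎)
    where
    B = toℚ ratio
    R = toℚ r
    N = toℚ n
    inv≤ : inv r * R * N ≤ N
    inv≤ = ℚ.≤-reflexive (trans (cong (_* N) (inv-* r)) (ℚ.*-identityˡ N))
    ε≤1 : ε * (B * R) * N ≤ N
    ε≤1 = begin
      ε * (B * R) * N                  ≡⟨ cong (λ q → ε * q * N) (toℚ-* ratio r) ⟨
      ε * toℚ (ratio ℕ.* r) * N        ≤⟨ *-monoʳ (0≤toℚ n) (≤inv⇒*≤1 (ratio ℕ.* r) (ratio ℕ.* r) (ℚ.<⇒≤ 0<ε) ℕ.≤-refl ε≤) ⟩
      1ℚ * N                           ≡⟨ ℚ.*-identityˡ N ⟩
      N                                ∎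

  -- If (1 + g)E ≤ n², then E ≤ γ(1 + g)E ≤ γn², so `S` would be γ-independent.
  manyEdges : ∀ {γ} g → 1ℚ ≤ γ * toℚ (suc g) → ∀ {n} (G : Digraph n) →
              (∀ (S : Subset n) → toℚ n * inv r ≤ toℚ ∣ S ∣ → ¬ γIndependent G γ S) →
              ∀ (S : Subset n) → n ℕ.≤ r ℕ.* ∣ S ∣ → n ℕ.* n ℕ.< suc g ℕ.* edgesIn G S
  manyEdges {γ} g 1≤γg {n} G dense S n≤ = ℕ.≰⇒> λ few → dense S large (independent few)
    where
    large : toℚ n * inv r ≤ toℚ ∣ S ∣
    large = begin
      toℚ n * inv r                    ≤⟨ *-monoʳ (ℚ.<⇒≤ (inv-pos r)) (toℚ-mono-≤ n≤) ⟩
      toℚ (r ℕ.* ∣ S ∣) * inv r        ≡⟨ cong (_* inv r) (toℚ-* r ∣ S ∣) ⟩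
      toℚ r * toℚ ∣ S ∣ * inv r        ≡⟨ solve 3 (λ ρ m i → ρ :* m :* i := i :* ρ :* m) refl (toℚ r) (toℚ ∣ S ∣) (inv r) ⟩
      inv r * toℚ r * toℚ ∣ S ∣        ≡⟨ trans (cong (_* toℚ ∣ S ∣) (inv-* r)) (ℚ.*-identityˡ _) ⟩
      toℚ ∣ S ∣                        ∎
    0≤γ : 0ℚ ≤ γ
    0≤γ = ℚ.*-cancelʳ-≤-pos (toℚ (suc g)) {{ℚ.normalize-pos (suc g) 1}} (begin
      0ℚ * toℚ (suc g)                 ≡⟨ ℚ.*-zeroˡ (toℚ (suc g)) ⟩
      0ℚ                               ≤⟨ 0≤toℚ 1 ⟩
      1ℚ                               ≤⟨ 1≤γg ⟩
      γ * toℚ (suc g)                  ∎)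
    independent : suc g ℕ.* edgesIn G S ℕ.≤ n ℕ.* n → γIndependent G γ S
    independent few = begin
      E                                ≡⟨ ℚ.*-identityˡ E ⟨
      1ℚ * E                           ≤⟨ *-monoʳ (0≤toℚ (edgesIn G S)) 1≤γg ⟩
      γ * toℚ (suc g) * E              ≡⟨ ℚ.*-assoc γ (toℚ (suc g)) E ⟩
      γ * (toℚ (suc g) * E)            ≡⟨ cong (γ *_) (toℚ-* (suc g) (edgesIn G S)) ⟨
      γ * toℚ (suc g ℕ.* edgesIn G S)  ≤⟨ *-monoˡ 0≤γ (toℚ-mono-≤ few) ⟩
      γ * toℚ (n ℕ.* n)                ∎
      where E = toℚ (edgesIn G S)

-- From the integer form to the rational hierarchy

fixedγ : ∀ r g n₁ ratio cost .{{_ : ℕ.NonZero r}} .{{_ : ℕ.NonZero ratio}} .{{_ : ℕ.NonZero cost}} →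
    Absorption r g n₁ ratio cost → ∀ γ → 1ℚ ≤ γ * toℚ (suc g) →
    ∃[ ξ₀ ] (0ℚ < ξ₀ × (∀ ξ → 0ℚ < ξ → ξ ≤ ξ₀ →
    ∃[ ε₀ ] (0ℚ < ε₀ × (∀ ε → 0ℚ < ε → ε ≤ ε₀ →
    ∃[ n₀ ] (∀ (n : ℕ) → n ≥ n₀ → (G : Digraph n) →
    (∀ x → ((1ℚ - inv r - ε) * toℚ n ≤ toℚ (outdeg G x))
    ⊎ ((1ℚ - inv r - ε) * toℚ n ≤ toℚ (indeg G x))) →
    (∀ (S : Subset n) → toℚ n * inv r ≤ toℚ ∣ S ∣ → ¬ γIndependent G γ S) →
    ∃[ M ] (toℚ ∣ M ∣ ≤ ξ * toℚ n ×
    (∀ (W : Subset n) → (∀ x → x ∈ W → x ∉ M) → r ∣ ∣ W ∣ →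
    toℚ ∣ W ∣ ≤ ξ * ξ * toℚ n → TrAbsorbing G r M W)))))))
fixedγ r g n₁ ratio cost absorption γ 1≤γg =
  inv ξ-threshold , inv-pos ξ-threshold , λ ξ 0<ξ ξ≤ →
  inv (ratio ℕ.* r) , inv-pos (ratio ℕ.* r) , λ ε 0<ε ε≤ →
  let (z , 1≤ξz) = archimedean ξ 0<ξ
      (s₀ , growth) = polynomial≤exponential (suc z ℕ.* cost) r
  -- The first summand is the least order allowed by `absorption`. The second forces s ≥ s₀, because
  -- n ≤ (z + 1) · cost · (s + 1).
  in n₁ ℕ.+ suc z ℕ.* cost ℕ.* suc s₀ , λ n n≥ G degree dense →
    let (s , affordable , optimal) = greatestAffordable 0<ξ ξ≤ n
        ξn≤ = ℚ.<⇒≤ (ℚ.≰⇒> optimal)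
        n≤ = n≤multiple 0<ξ ξ≤ n s ξn≤ z 1≤ξz
        s₀≤s = ℕ.s≤s⁻¹ (ℕ.*-cancelˡ-≤ {suc s₀} {suc s} (suc z ℕ.* cost) {{ℕ.m*n≢0 (suc z) cost}}
                 (ℕ.≤-trans (ℕ.m+n≤o⇒n≤o n₁ n≥) n≤))
        side = neighbourhood 0<ε ε≤ G degree
        (M , M≤ , absorbs) = absorption G s (ℕ.m+n≤o⇒m≤o n₁ n≥)
          (affordable⇒≤n 0<ξ ξ≤ n s affordable)
          (ℕ.≤-trans (ℕ.^-monoˡ-≤ r n≤) (growth s s₀≤s))
          (λ x → proj₁ (side x)) (λ x → proj₁ (proj₂ (side x))) (λ x → proj₂ (proj₂ (side x)))
          (manyEdges {γ} g 1≤γg G dense)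
    in M , ℚ.≤-trans (toℚ-mono-≤ M≤) affordable ,
       λ W W∩M≡∅ r∣W W≤ → absorbs W W∩M≡∅ r∣W (ξ²n⇒≤s 0<ξ ξ≤ n s ξn≤ ∣ W ∣ W≤)
  where
  open Rationals r ratio cost
  neighbourhood : ∀ {ε} → 0ℚ < ε → ε ≤ inv (ratio ℕ.* r) → ∀ {n} (G : Digraph n) →
    (∀ x → ((1ℚ - inv r - ε) * toℚ n ≤ toℚ (outdeg G x)) ⊎ ((1ℚ - inv r - ε) * toℚ n ≤ toℚ (indeg G x))) →
    ∀ x → Σ (Fin n → Bool) λ N →
      ((∀ y → N y ≡ true → Edge G r x y) ⊎ (∀ y → N y ≡ true → Edge G r y x)) ×
      ratio ℕ.* (r ℕ.* n) ℕ.≤ ratio ℕ.* (r ℕ.* card N ℕ.+ n) ℕ.+ n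
  neighbourhood {ε} 0<ε ε≤ {n} G degree x with degree x
  ... | inj₁ out = adj G x , inj₁ (λ _ → id) ,
    deficiency 0<ε ε≤ n _ (subst (λ c → (1ℚ - inv r - ε) * toℚ n ≤ toℚ c) (∣tabulate∣≡card (adj G x)) out)
  ... | inj₂ inn = (λ y → adj G y x) , inj₂ (λ _ → id) ,
    deficiency 0<ε ε≤ n _ (subst (λ c → (1ℚ - inv r - ε) * toℚ n ≤ toℚ c) (∣tabulate∣≡card (λ y → adj G y x)) inn)

theorem5p2 : (r : ℕ) → r ≥ 3 →
    ∃[ γ₀ ] (0ℚ < γ₀ × (∀ γ → 0ℚ < γ → γ ≤ γ₀ →
    ∃[ ξ₀ ] (0ℚ < ξ₀ × (∀ ξ → 0ℚ < ξ → ξ ≤ ξ₀ →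
    ∃[ ε₀ ] (0ℚ < ε₀ × (∀ ε → 0ℚ < ε → ε ≤ ε₀ →
    ∃[ n₀ ] (∀ (n : ℕ) → n ≥ n₀ → (G : Digraph n) →
    (∀ x → ((1ℚ - inv r - ε) * toℚ n ≤ toℚ (outdeg G x))
    ⊎ ((1ℚ - inv r - ε) * toℚ n ≤ toℚ (indeg G x))) →
    (∀ (S : Subset n) → toℚ n * inv r ≤ toℚ ∣ S ∣ → ¬ γIndependent G γ S) →
    ∃[ M ] (toℚ ∣ M ∣ ≤ ξ * toℚ n ×
    (∀ (W : Subset n) → (∀ x → x ∈ W → x ∉ M) → r ∣ ∣ W ∣ →
    toℚ ∣ W ∣ ≤ ξ * ξ * toℚ n → TrAbsorbing G r M W)))))))))
theorem5p2 r@(suc (suc (suc t))) (ℕ.s≤s (ℕ.s≤s (ℕ.s≤s ℕ.z≤n))) =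
  1ℚ , inv-pos 1 , λ γ 0<γ _ →
  -- Since 1 + g ≥ 1/γ, a set that is not γ-independent spans more than n²/(1 + g) edges; `g` stands
  -- for γ from here on.
  let (g , 1≤γg) = archimedean γ 0<γ
      open Constants t g using (ratio; cost; absorption)
  in fixedγ r g (12 ℕ.* suc g ℕ.* r) ratio cost absorption γ 1≤γg
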